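{- There is an absolute constant $c>0$ such that for all integers $k\ge 2$ and all integers $n\ge 3k$, $$r_k(n)\ge t_{k-1}(cn^2).$$
   Context: $r_k(n)$ denotes the minimum $N$ such that every coloring of the $k$-element subsets of an $N$-element set with $2$ colors contains a monochromatic subset of size $n$, i.e. a subset of size $n$ all of whose $k$-element subsets have the same color. The tower function $t_k(x)$ is defined by $t_1(x)=x$ and $t_{i+1}(x)=2^{t_i(x)}$. The constant $c$ does not depend on $k$ or $n$. -}

module Defs where

open import Data.Fin.Base using (Fin)
open import Data.Fin.Subset using (Subset; ∣_∣; _⊆_)
open import Data.Integer.Base as ℤ using (ℤ; -[1+_])
open import Data.Nat.Base as ℕ using (ℕ; zero; suc)
open import Data.Nat.Properties using (m^n≢0)
open import Data.Product.Base using (Σ; ∃; _×_; proj₁)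
open import Data.Rational.Base using (ℚ; 0ℚ; _/_; _<_; ↥_; ↧ₙ_; +-*-rawSemiring)
open import Data.Sum.Base using (_⊎_)
open import Level using (0ℓ)
open import Relation.Binary.PropositionalEquality.Core using (_≡_)
open import Relation.Unary using (Pred)
import Relation.Unary as Unary
open import Algebra.Definitions.RawSemiring +-*-rawSemiring using (_^_)

KSubset : ℕ → ℕ → Set
KSubset k N = Σ (Subset N) λ S → ∣ S ∣ ≡ k

Coloring : ℕ → ℕ → Set
Coloring k N = KSubset k N → Fin 2

Monochromatic : ∀ {k N} → Coloring k N → Subset N → Set
Monochromatic {k} {N} χ T =
  ∃ λ colour → (S : KSubset k N) → proj₁ S ⊆ T → χ S ≡ colour

Arrows : ℕ → ℕ → ℕ → Set
Arrows k n N = (χ : Coloring k N) → ∃ λ T → ∣ T ∣ ≡ n × Monochromatic χ T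

IsLeast : Pred ℕ 0ℓ → ℕ → Set
IsLeast P N = P N × (∀ M → P M → N ℕ.≤ M)

-- IsRamseyNumber k n N says that N = r_k(n).
IsRamseyNumber : ℕ → ℕ → ℕ → Set
IsRamseyNumber k n = IsLeast (Arrows k n)

-- The tower function takes irrational values at rational arguments, so its
-- values are represented as real numbers given by their open lower cuts:
-- y is represented by the predicate s ↦ (s < y) on ℚ, and the order on reals
-- is inclusion of cuts.
Cut : Set₁
Cut = Pred ℚ 0ℓ

fromℚ : ℚ → Cut
fromℚ q s = s < q

fromℕ : ℕ → ℚ
fromℕ n = ℤ.+ n / 1

infix 4 _≤ᶜ_
_≤ᶜ_ : Cut → Cut → Set
x ≤ᶜ y = x Unary.⊆ y

2^ℤ : ℤ → ℚ
2^ℤ (ℤ.+ n)  = fromℕ (2 ℕ.^ n)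
2^ℤ -[1+ n ] = (ℤ.+ 1 / (2 ℕ.^ suc n)) {{m^n≢0 2 (suc n)}}

-- For rational u = a/b with b > 0 and s ≥ 0, s < 2^u holds exactly when
-- s^b < 2^a; negative s lie below every power of 2.
infix 4 _<2^_
_<2^_ : ℚ → ℚ → Set
s <2^ u = s < 0ℚ ⊎ s ^ ↧ₙ u < 2^ℤ (↥ u)

-- The real number 2^y is the supremum of 2^u over rational u < y.
exp₂ : Cut → Cut
exp₂ y s = ∃ λ u → y u × s <2^ u

-- t_1(x) = x and t_{i+1}(x) = 2^{t_i(x)}. The index 0 is outside the domain of
-- the tower function and gets an arbitrary value.
tower : ℕ → Cut → Cut
tower zero          x = x
tower (suc zero)    x = x
tower (suc (suc i)) x = exp₂ (tower (suc i) x)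

{-# OPTIONS --safe #-}

-- For k = 2, 3 a random colouring works: with q of order n, the expected number
-- of monochromatic n-sets is less than 1 on q² resp. 2^q² vertices.  From k to
-- k + 1 one steps up from N to 2^N vertices: the vertices are 0-1 vectors, and
-- consecutive vertices v₀ < … < v_k first differ at coordinates δ₁, …, δ_k.
-- If the δ's are monotone, the colour is that of {δ₁,…,δ_k}; otherwise it
-- is the sum mod 2 of the length of the first monotone run and of a bit telling
-- whether that run increases.  This forces a monochromatic set to have an almost monotone
-- δ-sequence, so that a step costs only 2 (k odd) or 3 (k even) vertices, and a
-- factor 2 once, for k = 3.  The average cost 5/2 being less than 3, n ≥ 3k
-- leaves a base of size Ω(n).

module Submission where

open import Defs
open import Data.Nat.Base as ℕ using (ℕ; zero; suc; _∸_)
open import Data.Product.Base using (Σ; ∃; ∃₂; _×_; _,_; proj₁; proj₂)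
open import Data.Sum.Base using (_⊎_; inj₁; inj₂)
open import Relation.Binary.PropositionalEquality
  using (_≡_; _≢_; refl; sym; trans; cong; cong₂; subst; subst₂; module ≡-Reasoning)
open import Relation.Nullary using (¬_; yes; no; contradiction)

-- Record for each two consecutive splitting coordinates whether they rise or fall. Then k + 1
-- vertices become a word of k - 1 letters, and blocks of k + 1 consecutive vertices of a larger set
-- become the windows of its word. Moving a window one letter forward inside a run shortens its
-- first run by one and flips its colour. If all turning windows agree, then a run of two or more
-- letters cannot be followed by two further letters. A long enough word is therefore constant up to
-- one letter at one end or, when the window length k - 1 is odd, one letter at each end. These
-- letters, and the extra vertex needed to produce a given number of splitting coordinates, are the
-- cost of a step. Windows of two letters (k = 3) see only the change itself, so a word made of two
-- arbitrary runs survives and the longer run keeps just half of it. Windows of one letter have no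
-- turn, so triples cannot be reached from graphs in this way and need their own random colouring on
-- exponentially many vertices.

module Combinatorics where
  open import Data.Bool.Base using (Bool; true; false; not; if_then_else_; _xor_)
  open import Data.Bool.Properties using (not-involutive; not-¬)
  open import Data.Empty using (⊥; ⊥-elim)
  open import Data.Fin.Base using (Fin; zero; suc)
  open import Data.Fin.Subset using (Subset; inside; outside; ∣_∣; _⊆_; _∪_) renaming (⊥ to ∅)
  open import Data.Fin.Subset.Properties using (out⊆; s⊆s; drop-∷-⊆; ⊥⊆; ∪-identityˡ; ∪-identityʳ; ∣⊥∣≡0)
  open import Data.List.Base using (List; []; _∷_; _++_; _∷ʳ_; map; length; replicate; take; drop)
  open import Data.List.Membership.Propositional using (_∈_)
  open import Data.List.Membership.Propositional.Properties using (∈-map⁺; ∈-++⁺ˡ; ∈-++⁺ʳ)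
  open import Data.List.Properties
    using (length-++; length-map; length-replicate; length-take; take++drop≡id; ++-assoc; ++-identityʳ;
           ∷-injectiveʳ; ∷ʳ-injectiveˡ; ∷ʳ-injectiveʳ)
  open import Data.List.Relation.Unary.All as All using (All; []; _∷_)
  import Data.List.Relation.Unary.All.Properties as All
  open import Data.List.Relation.Unary.Any using (here; there)
  open import Data.Maybe.Base as Maybe using (Maybe; just; nothing; maybe′)
  open import Data.Nat.Base
  open import Data.Nat.Combinatorics using (_C_; nCk+nC[k+1]≡[n+1]C[k+1]; nC1≡n)
  open import Data.Nat.Properties
  open import Data.Nat.Tactic.RingSolver using (solve-∀)
  open import Data.Vec.Base as Vec using ([]; _∷_; here; there)
  import Data.Vec.Properties as Vec
  open import Function.Base using (_∘_)

  NotArrows : ℕ → ℕ → ℕ → Set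
  NotArrows k n N = Σ (Coloring k N) λ χ → ∀ T → ∣ T ∣ ≡ n → ¬ Monochromatic χ T

  colour : Bool → Fin 2
  colour false = zero
  colour true  = suc zero

  colour-surjective : ∀ c → ∃ λ b → colour b ≡ c
  colour-surjective zero       = false , refl
  colour-surjective (suc zero) = true , refl

  colour-injective : ∀ {b b′} → colour b ≡ colour b′ → b ≡ b′
  colour-injective {false} {false} _ = refl
  colour-injective {true}  {true}  _ = refl

  -- Random colourings

  ∑ : ∀ {X : Set} → List X → (X → ℕ) → ℕ
  ∑ []       f = 0
  ∑ (x ∷ xs) f = f x + ∑ xs f

  ∑-cong : ∀ {X : Set} (xs : List X) {f g : X → ℕ} → (∀ x → f x ≡ g x) → ∑ xs f ≡ ∑ xs g
  ∑-cong []       f≗g = refl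
  ∑-cong (x ∷ xs) f≗g = cong₂ _+_ (f≗g x) (∑-cong xs f≗g)

  ∑-+ : ∀ {X : Set} (xs : List X) (f g : X → ℕ) → ∑ xs (λ x → f x + g x) ≡ ∑ xs f + ∑ xs g
  ∑-+ []       f g = refl
  ∑-+ (x ∷ xs) f g = trans (cong (f x + g x +_) (∑-+ xs f g)) (interchange (f x) (g x) (∑ xs f) (∑ xs g))
    where
    interchange : ∀ a b c d → a + b + (c + d) ≡ a + c + (b + d)
    interchange = solve-∀

  ∑-*-const : ∀ {X : Set} (xs : List X) (f : X → ℕ) K P →
              All (λ x → f x * K ≡ P) xs → ∑ xs f * K ≡ length xs * P
  ∑-*-const []       f K P []       = refl
  ∑-*-const (x ∷ xs) f K P (p ∷ ps) =
    trans (*-distribʳ-+ K (f x) (∑ xs f)) (cong₂ _+_ p (∑-*-const xs f K P ps))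

  ∑<1⇒≡0 : ∀ {X : Set} {xs : List X} (f : X → ℕ) → ∑ xs f < 1 → ∀ {x} → x ∈ xs → f x ≡ 0
  ∑<1⇒≡0 {xs = x ∷ xs} f ∑<1 (here refl) = n<1⇒n≡0 (≤-<-trans (m≤m+n (f x) _) ∑<1)
  ∑<1⇒≡0 {xs = x ∷ xs} f ∑<1 (there x∈)  = ∑<1⇒≡0 f (≤-<-trans (m≤n+m _ (f x)) ∑<1) x∈

  -- Ranging over all subsets, not only those of size `k`, lets products follow the recursion of bit
  -- vectors; subsets of other sizes contribute fixed factors.
  ∏ : ∀ N → (Subset N → ℕ) → ℕ
  ∏ zero    f = f []
  ∏ (suc N) f = ∏ N (f ∘ (inside ∷_)) * ∏ N (f ∘ (outside ∷_))

  ∏-cong : ∀ N {f g : Subset N → ℕ} → (∀ S → f S ≡ g S) → ∏ N f ≡ ∏ N g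
  ∏-cong zero    f≗g = f≗g []
  ∏-cong (suc N) f≗g = cong₂ _*_ (∏-cong N (f≗g ∘ _)) (∏-cong N (f≗g ∘ _))

  ∏-one : ∀ N {f : Subset N → ℕ} → (∀ S → f S ≡ 1) → ∏ N f ≡ 1
  ∏-one zero    f≗1 = f≗1 []
  ∏-one (suc N) f≗1 = cong₂ _*_ (∏-one N (f≗1 ∘ _)) (∏-one N (f≗1 ∘ _))

  smaller-half : ∀ a b B → a + b < B * 2 → a < B ⊎ b < B
  smaller-half a b B a+b<2B with a <? B
  ... | yes a<B = inj₁ a<B
  ... | no  a≮B = inj₂ (+-cancelˡ-< B b B (≤-<-trans (+-monoˡ-≤ b (≮⇒≥ a≮B))
                      (subst (a + b <_) (trans (*-comm B 2) (cong (B +_) (+-identityʳ B))) a+b<2B)))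

  -- The method of conditional expectations: summing over all g : Subset N → Bool
  -- and dividing by their number shows that the hypothesis bounds the mean of
  -- the quantity in the conclusion.
  average : ∀ N {X : Set} (xs : List X) (e : X → ℕ) (u : X → Subset N → Bool → ℕ) B →
            ∑ xs (λ x → e x * ∏ N (λ S → u x S true + u x S false)) < B * ∏ N (λ _ → 2) →
            Σ (Subset N → Bool) λ g → ∑ xs (λ x → e x * ∏ N (λ S → u x S (g S))) < B
  average zero xs e u B mean<B
    with smaller-half (∑ xs (λ x → e x * u x [] true)) (∑ xs (λ x → e x * u x [] false)) B
           (subst (_< B * 2)
             (trans (∑-cong xs λ x → *-distribˡ-+ (e x) _ _) (∑-+ xs _ _)) mean<B)
  ... | inj₁ t<B = (λ _ → true) , t<B
  ... | inj₂ f<B = (λ _ → false) , f<B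
  average (suc N) xs e u B mean<B =
    -- The subsets containing the first element are coloured first, while `e` carries the factors of
    -- the other half summed over both colours. In the second call `e` carries the factors already
    -- chosen.
    let gᵢ , <ᵢ = average N xs
                    (λ x → e x * ∏ N (λ S → u x (outside ∷ S) true + u x (outside ∷ S) false))
                    (λ x → u x ∘ (inside ∷_)) (B * ∏ N (λ _ → 2))
                    (subst₂ _<_ (∑-cong xs λ x → swap (e x) _ _) (sym (*-assoc B _ _)) mean<B)
        gₒ , <ₒ = average N xs
                    (λ x → e x * ∏ N (λ S → u x (inside ∷ S) (gᵢ S)))
                    (λ x → u x ∘ (outside ∷_)) B
                    (subst (_< B * ∏ N (λ _ → 2)) (∑-cong xs λ x → comm (e x) _ _) <ᵢ)
    in  (λ { (inside ∷ S) → gᵢ S ; (outside ∷ S) → gₒ S })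
      , subst (_< B) (∑-cong xs λ x → *-assoc (e x) _ _) <ₒ
    where
    swap : ∀ a b c → a * (b * c) ≡ (a * c) * b
    swap = solve-∀
    comm : ∀ a b c → (a * b) * c ≡ (a * c) * b
    comm = solve-∀

  isKSubset : ∀ {N} → ℕ → Subset N → Subset N → Bool
  isKSubset zero    []            []            = true
  isKSubset (suc k) []            []            = false
  isKSubset k       (t ∷ T)       (outside ∷ S) = isKSubset k T S
  isKSubset k       (outside ∷ T) (inside ∷ S)  = false
  isKSubset zero    (inside ∷ T)  (inside ∷ S)  = false
  isKSubset (suc k) (inside ∷ T)  (inside ∷ S)  = isKSubset k T S

  isKSubset-sound : ∀ {N} k (T S : Subset N) → isKSubset k T S ≡ true → ∣ S ∣ ≡ k × S ⊆ T
  isKSubset-sound zero    []            []            eq = refl , λ ()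
  isKSubset-sound (suc k) []            []            ()
  isKSubset-sound zero    (t ∷ T)       (outside ∷ S) eq =
    let s , S⊆T = isKSubset-sound zero T S eq in s , out⊆ S⊆T
  isKSubset-sound (suc k) (t ∷ T)       (outside ∷ S) eq =
    let s , S⊆T = isKSubset-sound (suc k) T S eq in s , out⊆ S⊆T
  isKSubset-sound zero    (outside ∷ T) (inside ∷ S)  ()
  isKSubset-sound (suc k) (outside ∷ T) (inside ∷ S)  ()
  isKSubset-sound (suc k) (inside ∷ T)  (inside ∷ S)  eq =
    let s , S⊆T = isKSubset-sound k T S eq in cong suc s , s⊆s S⊆T

  -- The number of 2-colourings of all subsets in which every k-subset of T has
  -- one given colour.
  weight : ∀ {N} → ℕ → Subset N → ℕ
  weight {N} k T = ∏ N λ S → if isKSubset k T S then 1 else 2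

  -- Each `k`-subset of `T` loses one of its two choices. Pascal's rule sorts these subsets by
  -- whether they contain the first vertex.
  weight-count : ∀ {N} k (T : Subset N) → weight k T * 2 ^ (∣ T ∣ C k) ≡ ∏ N (λ _ → 2)
  weight-count zero    [] = refl
  weight-count (suc k) [] = refl
  weight-count {suc N} zero (outside ∷ T) =
    trans (*-assoc (∏ N _) _ _) (cong (∏ N (λ _ → 2) *_) (weight-count zero T))
  weight-count {suc N} (suc k) (outside ∷ T) =
    trans (*-assoc (∏ N _) _ _) (cong (∏ N (λ _ → 2) *_) (weight-count (suc k) T))
  weight-count {suc N} zero (inside ∷ T) =
    trans (*-assoc (∏ N _) _ _) (cong (∏ N (λ _ → 2) *_) (weight-count zero T))
  weight-count {suc N} (suc k) (inside ∷ T) = begin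
    weight k T * weight (suc k) T * 2 ^ (suc n C suc k)
      ≡⟨ cong (λ m → weight k T * weight (suc k) T * 2 ^ m) (nCk+nC[k+1]≡[n+1]C[k+1] n k) ⟨
    weight k T * weight (suc k) T * 2 ^ (n C k + n C suc k)
      ≡⟨ cong (weight k T * weight (suc k) T *_) (^-distribˡ-+-* 2 (n C k) (n C suc k)) ⟩
    weight k T * weight (suc k) T * (2 ^ (n C k) * 2 ^ (n C suc k))
      ≡⟨ [m*n]*[o*p]≡[m*o]*[n*p] (weight k T) _ _ _ ⟩
    weight k T * 2 ^ (n C k) * (weight (suc k) T * 2 ^ (n C suc k))
      ≡⟨ cong₂ _*_ (weight-count k T) (weight-count (suc k) T) ⟩
    ∏ N (λ _ → 2) * ∏ N (λ _ → 2) ∎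
    where
    open ≡-Reasoning
    n = ∣ T ∣

  subsetsOfSize : (n N : ℕ) → List (Subset N)
  subsetsOfSize zero    zero    = [] ∷ []
  subsetsOfSize (suc n) zero    = []
  subsetsOfSize zero    (suc N) = map (outside ∷_) (subsetsOfSize zero N)
  subsetsOfSize (suc n) (suc N) =
    map (inside ∷_) (subsetsOfSize n N) ++ map (outside ∷_) (subsetsOfSize (suc n) N)

  subsetsOfSize-complete : ∀ {N} (T : Subset N) → T ∈ subsetsOfSize ∣ T ∣ N
  subsetsOfSize-complete [] = here refl
  subsetsOfSize-complete (inside ∷ T) = ∈-++⁺ˡ (∈-map⁺ _ (subsetsOfSize-complete T))
  subsetsOfSize-complete (outside ∷ T) = outside-case ∣ T ∣ (subsetsOfSize-complete T)
    where
    outside-case : ∀ n → T ∈ subsetsOfSize n _ → outside ∷ T ∈ subsetsOfSize n _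
    outside-case zero    T∈ = ∈-map⁺ _ T∈
    outside-case (suc n) T∈ = ∈-++⁺ʳ (map (inside ∷_) (subsetsOfSize n _)) (∈-map⁺ _ T∈)

  subsetsOfSize-size : (n N : ℕ) → All (λ T → ∣ T ∣ ≡ n) (subsetsOfSize n N)
  subsetsOfSize-size zero    zero    = refl ∷ []
  subsetsOfSize-size (suc n) zero    = []
  subsetsOfSize-size zero    (suc N) = All.map⁺ (subsetsOfSize-size zero N)
  subsetsOfSize-size (suc n) (suc N) =
    All.++⁺ (All.map⁺ (All.map (cong suc) (subsetsOfSize-size n N)))
            (All.map⁺ (subsetsOfSize-size (suc n) N))

  length-subsetsOfSize : (n N : ℕ) → length (subsetsOfSize (suc n) (suc N)) ≡
                                 length (subsetsOfSize n N) + length (subsetsOfSize (suc n) N)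
  length-subsetsOfSize n N =
    trans (length-++ (map (inside ∷_) (subsetsOfSize n N)))
          (cong₂ _+_ (length-map _ (subsetsOfSize n N)) (length-map _ (subsetsOfSize (suc n) N)))

  subsetsOfSize≤2^ : (n N : ℕ) → length (subsetsOfSize n N) ≤ 2 ^ N
  subsetsOfSize≤2^ zero    zero    = ≤-refl
  subsetsOfSize≤2^ (suc n) zero    = z≤n
  subsetsOfSize≤2^ zero    (suc N) =
    ≤-trans (≤-reflexive (length-map _ (subsetsOfSize zero N)))
            (≤-trans (subsetsOfSize≤2^ zero N) (m≤m+n _ _))
  subsetsOfSize≤2^ (suc n) (suc N) = begin
    length (subsetsOfSize (suc n) (suc N))                          ≡⟨ length-subsetsOfSize n N ⟩
    length (subsetsOfSize n N) + length (subsetsOfSize (suc n) N)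
      ≤⟨ +-mono-≤ (subsetsOfSize≤2^ n N) (subsetsOfSize≤2^ (suc n) N) ⟩
    2 ^ N + 2 ^ N
      ≡⟨ cong (2 ^ N +_) (+-identityʳ (2 ^ N)) ⟨
    2 ^ suc N                                                       ∎
    where open ≤-Reasoning

  subsetsOfSize≤^ : (n N : ℕ) → length (subsetsOfSize n N) ≤ N ^ n
  subsetsOfSize≤^ zero    zero    = ≤-refl
  subsetsOfSize≤^ (suc n) zero    = z≤n
  subsetsOfSize≤^ zero    (suc N) =
    ≤-trans (≤-reflexive (length-map _ (subsetsOfSize zero N))) (subsetsOfSize≤^ zero N)
  subsetsOfSize≤^ (suc n) (suc N) = begin
    length (subsetsOfSize (suc n) (suc N))                          ≡⟨ length-subsetsOfSize n N ⟩
    length (subsetsOfSize n N) + length (subsetsOfSize (suc n) N)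
      ≤⟨ +-mono-≤ (subsetsOfSize≤^ n N) (subsetsOfSize≤^ (suc n) N) ⟩
    N ^ n + N * N ^ n
      ≤⟨ *-monoʳ-≤ (suc N) (^-monoˡ-≤ n (n≤1+n N)) ⟩
    suc N ^ suc n                                                   ∎
    where open ≤-Reasoning

  -- Union bound: an `n`-set is monochromatic in a given colour with probability 2^-(n C k), so the
  -- hypothesis makes the expected number of pairs of a set and a colour less than 1. Each indicator
  -- is a product over all subsets, the form that `average` handles.
  random-colouring : (k n N : ℕ) → 2 * length (subsetsOfSize n N) < 2 ^ (n C k) → NotArrows k n N
  random-colouring k n N few = χ , bad
    where
    Ts : List (Subset N)
    Ts = subsetsOfSize n N

    xs : List (Subset N × Bool)
    xs = map (_, true) Ts ++ map (_, false) Ts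

    agree : Bool → Bool → ℕ
    agree true  true  = 1
    agree false false = 1
    agree _     _     = 0

    monochromatic : Subset N × Bool → Subset N → Bool → ℕ
    monochromatic (T , c) S b = if isKSubset k T S then agree c b else 1

    cases : ∀ x S → monochromatic x S true + monochromatic x S false ≡
                    (if isKSubset k (proj₁ x) S then 1 else 2)
    cases (T , c) S with isKSubset k T S
    cases (T , true)  S | true  = refl
    cases (T , false) S | true  = refl
    cases (T , c)     S | false = refl

    volume : Subset N × Bool → ℕ
    volume x = 1 * ∏ N (λ S → monochromatic x S true + monochromatic x S false)

    mean : ℕ
    mean = ∑ xs volume

    colourings : ℕ
    colourings = ∏ N (λ _ → 2)

    each : ∀ c → All (λ x → volume x * 2 ^ (n C k) ≡ colourings) (map (_, c) Ts)
    each c = All.map⁺ {xs = Ts} (All.map one (subsetsOfSize-size n N))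
      where
      one : ∀ {T} → ∣ T ∣ ≡ n →
            volume (T , c) * 2 ^ (n C k) ≡ colourings
      one {T} refl = trans (cong (_* 2 ^ (n C k))
                             (trans (*-identityˡ _) (∏-cong N (cases (T , c)))))
                           (weight-count k T)

    length-xs : length xs ≡ 2 * length Ts
    length-xs = trans (length-++ (map (_, true) Ts) {map (_, false) Ts})
      (cong₂ _+_ (length-map _ Ts) (trans (length-map _ Ts) (sym (+-identityʳ _))))

    colourings>0 : ∀ N → 0 < ∏ N (λ _ → 2)
    colourings>0 zero    = z<s
    colourings>0 (suc N) = *-mono-< (colourings>0 N) (colourings>0 N)

    mean<1 : mean < 1 * colourings
    mean<1 = *-cancelʳ-< (2 ^ (n C k)) mean (1 * colourings) (begin-strict
      mean * 2 ^ (n C k)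
        ≡⟨ ∑-*-const xs volume (2 ^ (n C k)) colourings (All.++⁺ (each true) (each false)) ⟩
      length xs * colourings        ≡⟨ cong (_* colourings) length-xs ⟩
      2 * length Ts * colourings
        <⟨ *-monoˡ-< colourings {{>-nonZero (colourings>0 N)}} {2 * length Ts} few ⟩
      2 ^ (n C k) * colourings      ≡⟨ *-comm (2 ^ (n C k)) colourings ⟩
      colourings * 2 ^ (n C k)      ≡⟨ cong (_* 2 ^ (n C k)) (*-identityˡ colourings) ⟨
      1 * colourings * 2 ^ (n C k)  ∎)
      where open ≤-Reasoning

    count : (Subset N → Bool) → Subset N × Bool → ℕ
    count g x = 1 * ∏ N (λ S → monochromatic x S (g S))

    colouring : Σ (Subset N → Bool) λ g → ∑ xs (count g) < 1
    colouring = average N xs (λ _ → 1) monochromatic 1 mean<1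

    g : Subset N → Bool
    g = proj₁ colouring

    χ : Coloring k N
    χ (S , _) = colour (g S)

    in-xs : ∀ c {T} → T ∈ Ts → (T , c) ∈ xs
    in-xs true  T∈ = ∈-++⁺ˡ {ys = map (_, false) Ts} (∈-map⁺ (_, true) T∈)
    in-xs false T∈ = ∈-++⁺ʳ (map (_, true) Ts) (∈-map⁺ (_, false) T∈)

    agree-refl : ∀ b → agree b b ≡ 1
    agree-refl false = refl
    agree-refl true  = refl

    bad : ∀ T → ∣ T ∣ ≡ n → ¬ Monochromatic χ T
    bad T refl (c , mono) with colour-surjective c
    ... | b , refl = 1+n≢0 (trans (sym all-agree) none)
      where
      none : count g (T , b) ≡ 0
      none = ∑<1⇒≡0 (count g) (proj₂ colouring) (in-xs b (subsetsOfSize-complete T))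

      agrees : ∀ S → monochromatic (T , b) S (g S) ≡ 1
      agrees S with isKSubset k T S in eq
      ... | false = refl
      ... | true  = let s , S⊆T = isKSubset-sound k T S eq
                    in  trans (cong (agree b) (colour-injective (mono (S , s) S⊆T))) (agree-refl b)

      all-agree : count g (T , b) ≡ 1
      all-agree = trans (*-identityˡ _) (∏-one N agrees)

  2*nC2 : ∀ n → 2 * (suc n C 2) ≡ suc n * n
  2*nC2 zero    = refl
  2*nC2 (suc n) = begin
    2 * (suc (suc n) C 2)              ≡⟨ cong (2 *_) (nCk+nC[k+1]≡[n+1]C[k+1] (suc n) 1) ⟨
    2 * (suc n C 1 + suc n C 2)        ≡⟨ *-distribˡ-+ 2 (suc n C 1) _ ⟩
    2 * (suc n C 1) + 2 * (suc n C 2)  ≡⟨ cong₂ (λ a b → 2 * a + b) (nC1≡n (suc n)) (2*nC2 n) ⟩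
    2 * suc n + suc n * n              ≡⟨ identity n ⟩
    suc (suc n) * suc n                ∎
    where
    open ≡-Reasoning
    identity : ∀ n → 2 * suc n + suc n * n ≡ suc (suc n) * suc n
    identity = solve-∀

  6*nC3 : ∀ n → 6 * ((2 + n) C 3) ≡ (2 + n) * (1 + n) * n
  6*nC3 zero    = refl
  6*nC3 (suc n) = begin
    6 * ((3 + n) C 3)                             ≡⟨ cong (6 *_) (nCk+nC[k+1]≡[n+1]C[k+1] (2 + n) 2) ⟨
    6 * ((2 + n) C 2 + (2 + n) C 3)               ≡⟨ split ((2 + n) C 2) ((2 + n) C 3) ⟩
    3 * (2 * ((2 + n) C 2)) + 6 * ((2 + n) C 3)
      ≡⟨ cong₂ (λ a b → 3 * a + b) (2*nC2 (suc n)) (6*nC3 n) ⟩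
    3 * ((2 + n) * (1 + n)) + (2 + n) * (1 + n) * n ≡⟨ identity n ⟩
    (3 + n) * (2 + n) * (1 + n)                   ∎
    where
    open ≡-Reasoning
    split : ∀ a b → 6 * (a + b) ≡ 3 * (2 * a) + 6 * b
    split = solve-∀
    identity : ∀ n → 3 * ((2 + n) * (1 + n)) + (2 + n) * (1 + n) * n ≡ (3 + n) * (2 + n) * (1 + n)
    identity = solve-∀

  few-subsets : ∀ k n N M → length (subsetsOfSize n N) ≤ 2 ^ M → suc M < n C k → NotArrows k n N
  few-subsets k n N M len≤ M< = random-colouring k n N
    (≤-<-trans (*-monoʳ-≤ 2 len≤) (^-monoʳ-< 2 (s<s z<s) M<))

  graph-colouring : ∀ p → NotArrows 2 (4 * suc p) (suc p * suc p)
  -- Counting all subsets is good enough, since the number of vertices is only quadratic in `n`: q²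
  -- + 1 is below 8q² - 2q.
  graph-colouring p = few-subsets 2 n q² q² (subsetsOfSize≤2^ n q²)
    (*-cancelˡ-< 2 (suc q²) (n C 2) (begin-strict
    2 * suc q²                            <⟨ m<m+n (2 * suc q²) (z<s {14 * p * p + 24 * p + 7}) ⟩
    2 * suc q² + suc (14 * p * p + 24 * p + 7)  ≡⟨ identity p ⟩
    (4 * p + 4) * (4 * p + 3)             ≡⟨ cong₂ _*_ (size p) refl ⟨
    suc (4 * p + 3) * (4 * p + 3)         ≡⟨ 2*nC2 (4 * p + 3) ⟨
    2 * (suc (4 * p + 3) C 2)             ≡⟨ cong (λ m → 2 * (m C 2)) (size′ p) ⟩
    2 * (n C 2)                           ∎))
    where
    open ≤-Reasoning
    n = 4 * suc p
    q² = suc p * suc p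
    size : ∀ p → suc (4 * p + 3) ≡ 4 * p + 4
    size = solve-∀
    size′ : ∀ p → suc (4 * p + 3) ≡ 4 * suc p
    size′ = solve-∀
    identity : ∀ p → 2 * suc (suc p * suc p) + suc (14 * p * p + 24 * p + 7) ≡ (4 * p + 4) * (4 * p + 3)
    identity = solve-∀

  triple-colouring : ∀ p → NotArrows 3 (6 * suc p) (2 ^ (suc p * suc p))
  -- There are at most 2^(q² n) sets of size n = 6q, an exponent of 6q³ against roughly 36q³
  -- triples.
  triple-colouring p = few-subsets 3 n (2 ^ q²) (q² * n)
    (≤-trans (subsetsOfSize≤^ n (2 ^ q²)) (≤-reflexive (^-*-assoc 2 q² n)))
    (*-cancelˡ-< 6 (suc (q² * n)) (n C 3) (begin-strict
    6 * suc (q² * n)                         <⟨ m<m+n (6 * suc (q² * n)) (z<s {d}) ⟩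
    6 * suc (q² * n) + suc d                 ≡⟨ identity p ⟩
    (2 + (6 * p + 4)) * (1 + (6 * p + 4)) * (6 * p + 4)  ≡⟨ 6*nC3 (6 * p + 4) ⟨
    6 * ((2 + (6 * p + 4)) C 3)              ≡⟨ cong (λ m → 6 * (m C 3)) (size p) ⟩
    6 * (n C 3)                              ∎))
    where
    open ≤-Reasoning
    n = 6 * suc p
    q² = suc p * suc p
    -- `suc d` is the difference of the two sides, expanded in `p`; nonnegative coefficients make
    -- the strict inequality evident.
    d = 180 * p * p * p + 432 * p * p + 336 * p + 77
    size : ∀ p → 2 + (6 * p + 4) ≡ 6 * suc p
    size = solve-∀
    identity : ∀ p → 6 * suc (suc p * suc p * (6 * suc p)) +
                       suc (180 * p * p * p + 432 * p * p + 336 * p + 77) ≡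
                     (2 + (6 * p + 4)) * (1 + (6 * p + 4)) * (6 * p + 4)
    identity = solve-∀

  -- Monotonicity in the size of the avoided sets and in the number of vertices

  subset-of-size : ∀ {N} (T : Subset N) {m} → m ≤ ∣ T ∣ → ∃ λ S → ∣ S ∣ ≡ m × S ⊆ T
  subset-of-size []            z≤n = [] , refl , λ ()
  subset-of-size (outside ∷ T) m≤T =
    let S , s , S⊆T = subset-of-size T m≤T in outside ∷ S , s , out⊆ S⊆T
  subset-of-size (inside ∷ T) z≤n =
    let S , s , S⊆T = subset-of-size T z≤n in outside ∷ S , s , out⊆ S⊆T
  subset-of-size (inside ∷ T) (s≤s m≤T) =
    let S , s , S⊆T = subset-of-size T m≤T in inside ∷ S , cong suc s , s⊆s S⊆T

  NotArrows-monoˡ : ∀ {k n n′ N} → n ≤ n′ → NotArrows k n N → NotArrows k n′ N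
  NotArrows-monoˡ n≤n′ (χ , bad) = χ , λ T ∣T∣≡n′ (c , mono) →
    let S , s , S⊆T = subset-of-size T (≤-trans n≤n′ (≤-reflexive (sym ∣T∣≡n′)))
    in  bad S s (c , λ K K⊆S → mono K (λ x∈K → S⊆T (K⊆S x∈K)))

  NotArrows-predʳ : ∀ {k n N} → NotArrows k n (suc N) → NotArrows k n N
  NotArrows-predʳ {k} {n} {N} (χ , bad) = χ′ , λ T ∣T∣≡n (c , mono) →
    bad (outside ∷ T) ∣T∣≡n (c , lift T c mono)
    where
    χ′ : Coloring k N
    χ′ (S , s) = χ (outside ∷ S , s)
    lift : ∀ T c → (∀ S → proj₁ S ⊆ T → χ′ S ≡ c) → ∀ S → proj₁ S ⊆ outside ∷ T → χ S ≡ c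
    lift T c mono (outside ∷ S , s) S⊆T = mono (S , s) (drop-∷-⊆ S⊆T)
    lift T c mono (inside ∷ S , s)  S⊆T = contradiction (S⊆T here) λ ()

  NotArrows-monoʳ : ∀ {k n N M} → M ≤′ N → NotArrows k n N → NotArrows k n M
  NotArrows-monoʳ (≤′-reflexive refl) na = na
  NotArrows-monoʳ (≤′-step M≤N)       na = NotArrows-monoʳ M≤N (NotArrows-predʳ na)

  NotArrows⇒¬Arrows : ∀ {k n N} → NotArrows k n N → ¬ Arrows k n N
  NotArrows⇒¬Arrows (χ , bad) arrows = let T , t , mono = arrows χ in bad T t mono

  -- Words in which all windows of a fixed length turn alike

  Word : Set
  Word = List Bool

  -- x negated j ∸ 1 times, for a non-constant word with first run xʲ.
  turn : Word → Maybe Bool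
  turn []          = nothing
  turn (x ∷ [])    = nothing
  turn (x ∷ y ∷ w) = if x xor y then just x else Maybe.map not (turn (y ∷ w))

  turn-constant : ∀ x n → turn (replicate n x) ≡ nothing
  turn-constant x     zero          = refl
  turn-constant x     (suc zero)    = refl
  turn-constant false (suc (suc n)) rewrite turn-constant false (suc n) = refl
  turn-constant true  (suc (suc n)) rewrite turn-constant true  (suc n) = refl

  flips : ℕ → Bool → Bool
  flips zero    x = x
  flips (suc n) x = not (flips n x)

  flips-even : ∀ n x → flips (n * 2) x ≡ x
  flips-even zero    x = refl
  flips-even (suc n) x = trans (not-involutive _) (flips-even n x)

  turn-run : ∀ j x w → turn (replicate (suc j) x ++ not x ∷ w) ≡ just (flips j x)
  turn-run zero    false w = refl
  turn-run zero    true  w = refl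
  turn-run (suc j) false w rewrite turn-run j false w = refl
  turn-run (suc j) true  w rewrite turn-run j true w = refl

  take-run : ∀ j d (x : Bool) w → take (j + suc d) (replicate j x ++ not x ∷ w) ≡
                                  replicate j x ++ not x ∷ take d w
  take-run zero    d x w = refl
  take-run (suc j) d x w = cong (x ∷_) (take-run j d x w)

  -- Only windows with a turn are compared, because constant windows take their colour from the
  -- smaller uniformity. Positions are given as factorisations, the form in which `window` turns
  -- them into sets of vertices.
  record Consistent (h : ℕ) (w : Word) : Set where
    field
      same-turn : ∀ p v q p′ v′ q′ {b b′} →
        w ≡ p ++ v ++ q → length v ≡ h → turn v ≡ just b →
        w ≡ p′ ++ v′ ++ q′ → length v′ ≡ h → turn v′ ≡ just b′ → b ≡ b′

  open Consistent

  Consistent-tail : ∀ {h x w} → Consistent h (x ∷ w) → Consistent h w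
  Consistent-tail {x = x} con .same-turn p v q p′ v′ q′ eq len t eq′ len′ t′ =
    con .same-turn (x ∷ p) v q (x ∷ p′) v′ q′ (cong (x ∷_) eq) len t (cong (x ∷_) eq′) len′ t′

  Consistent-prefixes : ∀ {h x w b b′} → Consistent h (x ∷ w) → h ≤ length w →
    turn (take h (x ∷ w)) ≡ just b → turn (take h w) ≡ just b′ → b ≡ b′
  Consistent-prefixes {h} {x} {w} con h≤w t t′ =
    con .same-turn [] (take h (x ∷ w)) (drop h (x ∷ w)) (x ∷ []) (take h w) (drop h w)
      (sym (take++drop≡id h (x ∷ w))) (trans (length-take h (x ∷ w)) (m≤n⇒m⊓n≡m (m≤n⇒m≤1+n h≤w))) t
      (cong (x ∷_) (sym (take++drop≡id h w))) (trans (length-take h w) (m≤n⇒m⊓n≡m h≤w)) t′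

  -- The index describes what follows a letter `x`, so `run j w` stands for a first run of length 1
  -- + j in the whole word.
  data FirstRun (x : Bool) : Word → Set where
    constant : ∀ n → FirstRun x (replicate n x)
    run      : ∀ j w → FirstRun x (replicate j x ++ not x ∷ w)

  firstRun : ∀ x w → FirstRun x w
  firstRun x     []          = constant 0
  firstRun false (true ∷ w)  = run 0 w
  firstRun true  (false ∷ w) = run 0 w
  firstRun false (false ∷ w) with firstRun false w
  ... | constant n = constant (suc n)
  ... | run j w′   = run (suc j) w′
  firstRun true (true ∷ w) with firstRun true w
  ... | constant n = constant (suc n)
  ... | run j w′   = run (suc j) w′

  length-run : ∀ j (x y : Bool) w → length (replicate j x ++ y ∷ w) ≡ j + suc (length w)
  length-run j x y w = trans (length-++ (replicate j x)) (cong (_+ suc (length w)) (length-replicate j))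

  -- Two windows that start one letter apart inside the first run have opposite
  -- turns.
  no-long-first-run : ∀ {h} j x y w → 3 ≤ h → h < (2 + j) + suc (suc (length w)) →
    ¬ Consistent h (replicate (2 + j) x ++ not x ∷ y ∷ w)
  no-long-first-run {h} j x y w 3≤h h< con with 3 + j ≤? h
  ... | yes 3+j≤h = not-¬ {flips j x} refl
    (sym (Consistent-prefixes con h≤ (t (suc j) d eq) (t j (suc d) eq′)))
    where
    d : ℕ
    d = h ∸ (3 + j)
    eq : h ≡ (2 + j) + suc d
    eq = trans (sym (m+[n∸m]≡n 3+j≤h)) (cong (2 +_) (sym (+-suc j d)))
    eq′ : h ≡ (1 + j) + suc (suc d)
    eq′ = trans eq (cong suc (sym (+-suc j (suc d))))
    t : ∀ j d → h ≡ (1 + j) + suc d →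
        turn (take h (replicate (1 + j) x ++ not x ∷ y ∷ w)) ≡ just (flips j x)
    t j d refl = trans (cong turn (take-run (suc j) d x (y ∷ w))) (turn-run j x (take d (y ∷ w)))
    h≤ : h ≤ length (replicate (1 + j) x ++ not x ∷ y ∷ w)
    h≤ = ≤-trans (s≤s⁻¹ h<) (≤-reflexive (sym (length-run (1 + j) x (not x) (y ∷ w))))
  -- The run fills the whole first window. Its letters are removed one at a time until a window
  -- reaches past its end, which happens with at least three of them left as `h` is at least 3.
  ... | no 3+j≰h with j
  ...   | zero   = contradiction 3≤h 3+j≰h
  ...   | suc j′ = no-long-first-run j′ x y w 3≤h
    (≤-trans (≰⇒> 3+j≰h) (≤-trans (≤-reflexive (+-comm 2 (2 + j′)))
      (+-monoʳ-≤ (2 + j′) (s≤s (s≤s z≤n)))))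
    (Consistent-tail con)

  data Almost (d : ℕ) : Word → Set where
    almost : ∀ p r x q → length p + length q ≤ d → Almost d (p ++ replicate r x ++ q)

  data Bracketed : Word → Set where
    bracketed : ∀ x r → Bracketed (x ∷ replicate r (not x) ++ x ∷ [])

  -- A first run followed by two letters must be a single letter, and the same argument then applies
  -- to the second run. The bound `2 + h` leaves room for two windows even after the first letter is
  -- removed.
  classify : ∀ {h} w → 3 ≤ h → 2 + h ≤ length w → Consistent h w → Almost 1 w ⊎ Bracketed w
  classify {h} (x ∷ w) 3≤h h≤ con = go (firstRun x w) h≤ con
    where
    go : ∀ {w} → FirstRun x w → 2 + h ≤ length (x ∷ w) → Consistent h (x ∷ w) →
         Almost 1 (x ∷ w) ⊎ Bracketed (x ∷ w)
    go (constant n) h≤ con = inj₁ (subst (Almost 1) (++-identityʳ _) (almost [] (suc n) x [] z≤n))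
    go (run j [])   h≤ con = inj₁ (almost [] (suc j) x (not x ∷ []) ≤-refl)
    go (run (suc j) (y ∷ w)) h≤ con = contradiction con
      (no-long-first-run j x y w 3≤h (≤-trans (n≤1+n _) (≤-trans h≤
        (≤-reflexive (length-run (2 + j) x (not x) (y ∷ w))))))
    go (run zero w) h≤ con = second (firstRun (not x) w) h≤ con
      where
      second : ∀ {w} → FirstRun (not x) w → 2 + h ≤ length (x ∷ not x ∷ w) →
               Consistent h (x ∷ not x ∷ w) → Almost 1 (x ∷ not x ∷ w) ⊎ Bracketed (x ∷ not x ∷ w)
      second (constant n) h≤ con =
        inj₁ (subst (λ v → Almost 1 (x ∷ v)) (++-identityʳ _)
          (almost (x ∷ []) (suc n) (not x) [] ≤-refl))
      second (run j []) h≤ con rewrite not-involutive x = inj₂ (bracketed x (suc j))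
      second (run (suc j) (y ∷ w)) h≤ con = contradiction (Consistent-tail con)
        (no-long-first-run j (not x) y w 3≤h (≤-trans (s≤s⁻¹ h≤)
          (≤-reflexive (length-run (2 + j) (not x) _ (y ∷ w)))))
      -- The word starts with three alternating letters, so the windows at the first two positions
      -- turn at once, at opposite letters.
      second (run zero (y ∷ w)) h≤ con = ⊥-elim
        (turns 3≤h (s≤s⁻¹ (≤-trans (n≤1+n _) h≤)) con)
        where
        turns : ∀ {h} → 3 ≤ h → h ≤ length (not x ∷ not (not x) ∷ y ∷ w) →
                Consistent h (x ∷ not x ∷ not (not x) ∷ y ∷ w) → ⊥
        turns {suc (suc (suc h))} (s≤s (s≤s (s≤s _))) h≤ con = not-¬ refl (Consistent-prefixes con h≤
          (turn-run 0 x (not (not x) ∷ take h (y ∷ w))) (turn-run 0 (not x) (y ∷ take h w)))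

  HasRun : ℕ → Word → Set
  HasRun r w = ∃ λ p → ∃₂ λ x q → w ≡ p ++ replicate r x ++ q

  replicate-≤ : ∀ {m n} (x : Bool) w → m ≤ n → ∃ λ v → replicate n x ++ w ≡ replicate m x ++ v
  replicate-≤ {n = n} x w z≤n = replicate n x ++ w , refl
  replicate-≤ x w (s≤s m≤n) = let v , eq = replicate-≤ x w m≤n in v , cong (x ∷_) eq

  Almost⇒HasRun : ∀ {d r w} → Almost d w → length w ≡ d + r → HasRun r w
  Almost⇒HasRun {d} {r} (almost p n x q ≤d) len =
    let v , eq = replicate-≤ x q r≤n in p , x , v , cong (p ++_) eq
    where
    total : length p + length q + n ≡ d + r
    total = begin
      length p + length q + n              ≡⟨ +-assoc (length p) (length q) n ⟩
      length p + (length q + n)            ≡⟨ cong (length p +_) (+-comm (length q) n) ⟩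
      length p + (n + length q)
        ≡⟨ cong (λ m → length p + (m + length q)) (length-replicate n {x}) ⟨
      length p + (length (replicate n x) + length q) ≡⟨ cong (length p +_) (length-++ (replicate n x)) ⟨
      length p + length (replicate n x ++ q) ≡⟨ length-++ p ⟨
      length (p ++ replicate n x ++ q)     ≡⟨ len ⟩
      d + r                                ∎
      where open ≡-Reasoning
    r≤n : r ≤ n
    r≤n = +-cancelˡ-≤ d r n (≤-trans (≤-reflexive (sym total)) (+-monoˡ-≤ n ≤d))

  Bracketed⇒Almost : ∀ {w} → Bracketed w → Almost 2 w
  Bracketed⇒Almost (bracketed x r) = almost (x ∷ []) r (not x) (x ∷ []) ≤-refl

  Almost-1⇒2 : ∀ {w} → Almost 1 w → Almost 2 w
  Almost-1⇒2 (almost p r x q ≤1) = almost p r x q (m≤n⇒m≤1+n ≤1)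

  replicate-+ : ∀ m n (x : Bool) w → replicate (m + n) x ++ w ≡ replicate m x ++ (replicate n x ++ w)
  replicate-+ zero    n x w = refl
  replicate-+ (suc m) n x w = cong (x ∷_) (replicate-+ m n x w)

  -- The first window turns at x; the last one turns at not x, negated an even
  -- number of times.
  even-not-bracketed : ∀ i {w} → 2 + 2 + i * 2 ≤ length w → Consistent (2 + i * 2) w → ¬ Bracketed w
  even-not-bracketed i h≤ con (bracketed x r) = not-¬ {x} refl
    (con .same-turn [] (x ∷ replicate m y) (replicate s y ++ x ∷ [])
       (x ∷ replicate s y) (replicate m y ++ not y ∷ []) []
       first (cong suc (length-replicate m)) (turn-run 0 x (replicate (i * 2) y))
       last (trans (length-run m y (not y) []) (+-comm m 1))
       (trans (turn-run (i * 2) y []) (cong just (flips-even i y))))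
    where
    y = not x
    m = suc (i * 2)
    s = r ∸ m

    m≤r : m ≤ r
    m≤r = +-cancelˡ-≤ 2 m r (≤-trans (n≤1+n _) (≤-trans h≤
      (≤-reflexive (cong suc (trans (length-run r y x []) (+-comm r 1))))))

    first : x ∷ replicate r y ++ x ∷ [] ≡ x ∷ replicate m y ++ (replicate s y ++ x ∷ [])
    first = cong (x ∷_) (trans (cong (λ n → replicate n y ++ x ∷ []) (sym (m+[n∸m]≡n m≤r)))
                               (replicate-+ m s y (x ∷ [])))

    last : x ∷ replicate r y ++ x ∷ [] ≡ x ∷ replicate s y ++ ((replicate m y ++ not y ∷ []) ++ [])
    last = cong (x ∷_) (begin
      replicate r y ++ x ∷ []
        ≡⟨ cong₂ (λ n z → replicate n y ++ z ∷ []) (sym (m∸n+n≡m m≤r)) (sym (not-involutive x)) ⟩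
      replicate (s + m) y ++ not y ∷ []                  ≡⟨ replicate-+ s m y (not y ∷ []) ⟩
      replicate s y ++ (replicate m y ++ not y ∷ [])     ≡⟨ cong (replicate s y ++_) (++-identityʳ _) ⟨
      replicate s y ++ ((replicate m y ++ not y ∷ []) ++ []) ∎)
      where open ≡-Reasoning

  run-even : ∀ i {r w} → 2 + 2 + i * 2 ≤ length w → length w ≡ 1 + r → 1 ≤ i →
             Consistent (2 + i * 2) w → HasRun r w
  run-even i {w = w} h≤ len 1≤i con with classify w (s≤s (s≤s (≤-trans 1≤i (m≤m*n i 2)))) h≤ con
  ... | inj₁ alm = Almost⇒HasRun alm len
  ... | inj₂ bra = contradiction bra (even-not-bracketed i h≤ con)

  -- For odd `h` a long bracketed word is consistent, so both end letters have to be given up.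
  run-any : ∀ {h r w} → 3 ≤ h → 2 + h ≤ length w → length w ≡ 2 + r → Consistent h w → HasRun r w
  run-any {w = w} 3≤h h≤ len con with classify w 3≤h h≤ con
  ... | inj₁ alm = Almost⇒HasRun (Almost-1⇒2 alm) len
  ... | inj₂ bra = Almost⇒HasRun (Bracketed⇒Almost bra) len

  -- A window of two letters turns exactly if they differ, and its turn is its first letter. All
  -- changes thus go the same way, so there is at most one, and the longer of two runs has more than
  -- half of the letters.
  run-two : ∀ r {w} → length w ≡ suc (r + r) → Consistent 2 w → HasRun (suc r) w
  run-two r {x ∷ w} len con = go (firstRun x w) len con
    where
    go : ∀ {w} → FirstRun x w → length (x ∷ w) ≡ suc (r + r) → Consistent 2 (x ∷ w) →
         HasRun (suc r) (x ∷ w)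
    go (constant n) len con =
      let n≡ = trans (sym (length-replicate n)) (suc-injective len)
          v , eq = replicate-≤ x [] (s≤s (≤-trans (m≤m+n r r) (≤-reflexive (sym n≡))))
      in  [] , x , v , trans (sym (++-identityʳ _)) eq
    go (run j w) len con = second (firstRun (not x) w) len con
      where
      second : ∀ {w} → FirstRun (not x) w → length (x ∷ replicate j x ++ not x ∷ w) ≡ suc (r + r) →
               Consistent 2 (x ∷ replicate j x ++ not x ∷ w) →
               HasRun (suc r) (x ∷ replicate j x ++ not x ∷ w)
      second (constant n) len con with r ≤? j
      ... | yes r≤j = let v , eq = replicate-≤ x _ (s≤s r≤j) in [] , x , v , eq
      ... | no  r≰j =
        let v , eq = replicate-≤ (not x) [] (s≤s r≤n)
        in  replicate (suc j) x , not x , v ,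
            cong (replicate (suc j) x ++_) (trans (sym (++-identityʳ _)) eq)
        where
        total : suc j + n ≡ r + r
        total = trans (sym (+-suc j n)) (trans (cong (λ m → j + suc m) (sym (length-replicate n)))
                  (trans (sym (length-run j x (not x) (replicate n (not x)))) (suc-injective len)))
        r≤n : r ≤ n
        r≤n = +-cancelˡ-≤ r r n (≤-trans (≤-reflexive (sym total)) (+-monoˡ-≤ n (≰⇒> r≰j)))
      second (run i w) len con = ⊥-elim (not-¬ refl
        (con .same-turn (replicate j x) (x ∷ not x ∷ []) (replicate i (not x) ++ not (not x) ∷ w)
           (replicate (suc j) x ++ replicate i (not x)) (not x ∷ not (not x) ∷ []) w
           (shift j x _) refl (turn-run 0 x [])
           (cong (x ∷_) (trans (cong (replicate j x ++_) (shift i (not x) _))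
                          (sym (++-assoc (replicate j x) _ _))))
           refl (turn-run 0 (not x) [])))
        where
        shift : ∀ j (x : Bool) w → x ∷ replicate j x ++ w ≡ replicate j x ++ x ∷ w
        shift zero    x w = refl
        shift (suc j) x w = cong (x ∷_) (shift j x w)

  -- The nonempty subsets of {0,1}ᴺ as binary tries: two vertices of the subset
  -- first differ at the node where their paths part.
  data Trie : ℕ → Set where
    leaf    : Trie 0
    left    : ∀ {N} → Trie N → Trie (suc N)
    right   : ∀ {N} → Trie N → Trie (suc N)
    node    : ∀ {N} → Trie N → Trie N → Trie (suc N)

  infixr 5 _⊎ˢ_
  -- The trailing empty vector matches `2 * m`, which unfolds to `m + (m + 0)`, so that `2 ^ suc N`
  -- needs no transport.
  _⊎ˢ_ : ∀ {m} → Subset m → Subset m → Subset (2 * m)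
  S ⊎ˢ T = S Vec.++ (T Vec.++ [])

  toSubset : ∀ {N} → Trie N → Subset (2 ^ N)
  toSubset leaf       = inside ∷ []
  toSubset (left t)   = toSubset t ⊎ˢ ∅
  toSubset (right t)  = ∅ ⊎ˢ toSubset t
  toSubset (node s t) = toSubset s ⊎ˢ toSubset t

  join : ∀ {N} → Maybe (Trie N) → Maybe (Trie N) → Maybe (Trie (suc N))
  join nothing  nothing  = nothing
  join (just s) nothing  = just (left s)
  join nothing  (just t) = just (right t)
  join (just s) (just t) = just (node s t)

  fromSubset : ∀ N → Subset (2 ^ N) → Maybe (Trie N)
  fromSubset zero    (inside ∷ [])  = just leaf
  fromSubset zero    (outside ∷ []) = nothing
  fromSubset (suc N) S = join (fromSubset N (Vec.take (2 ^ N) S))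
                              (fromSubset N (Vec.take (2 ^ N) (Vec.drop (2 ^ N) S)))

  take-++ : ∀ {A : Set} {m n} (xs : Vec.Vec A m) (ys : Vec.Vec A n) → Vec.take m (xs Vec.++ ys) ≡ xs
  take-++ []       ys = refl
  take-++ (x ∷ xs) ys = cong (x ∷_) (take-++ xs ys)

  drop-++ : ∀ {A : Set} {m n} (xs : Vec.Vec A m) (ys : Vec.Vec A n) → Vec.drop m (xs Vec.++ ys) ≡ ys
  drop-++ []       ys = refl
  drop-++ (x ∷ xs) ys = drop-++ xs ys

  fromSubset-⊎ˢ : ∀ N (S T : Subset (2 ^ N)) →
                  fromSubset (suc N) (S ⊎ˢ T) ≡ join (fromSubset N S) (fromSubset N T)
  fromSubset-⊎ˢ N S T = cong₂ (λ S T → join (fromSubset N S) (fromSubset N T))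
    (take-++ S (T Vec.++ []))
    (trans (cong (Vec.take (2 ^ N)) (drop-++ S (T Vec.++ []))) (take-++ T []))

  ⊥-++ : ∀ m n → ∅ {m + n} ≡ ∅ {m} Vec.++ ∅ {n}
  ⊥-++ zero    n = refl
  ⊥-++ (suc m) n = cong (outside ∷_) (⊥-++ m n)

  ⊥-⊎ˢ : ∀ m → ∅ {2 * m} ≡ ∅ {m} ⊎ˢ ∅ {m}
  ⊥-⊎ˢ m = trans (⊥-++ m (m + 0)) (cong (∅ {m} Vec.++_) (⊥-++ m 0))

  fromSubset-⊥ : ∀ N → fromSubset N ∅ ≡ nothing
  fromSubset-⊥ zero    = refl
  fromSubset-⊥ (suc N) = trans (cong (fromSubset (suc N)) (⊥-⊎ˢ (2 ^ N)))
    (trans (fromSubset-⊎ˢ N ∅ ∅) (cong (λ t → join t t) (fromSubset-⊥ N)))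

  fromSubset-toSubset : ∀ {N} (t : Trie N) → fromSubset N (toSubset t) ≡ just t
  fromSubset-toSubset leaf = refl
  fromSubset-toSubset (left t) =
    trans (fromSubset-⊎ˢ _ (toSubset t) ∅) (cong₂ join (fromSubset-toSubset t) (fromSubset-⊥ _))
  fromSubset-toSubset (right t) =
    trans (fromSubset-⊎ˢ _ ∅ (toSubset t)) (cong₂ join (fromSubset-⊥ _) (fromSubset-toSubset t))
  fromSubset-toSubset (node s t) =
    trans (fromSubset-⊎ˢ _ (toSubset s) (toSubset t))
          (cong₂ join (fromSubset-toSubset s) (fromSubset-toSubset t))

  ∣++∣ : ∀ {m n} (S : Subset m) (T : Subset n) → ∣ S Vec.++ T ∣ ≡ ∣ S ∣ + ∣ T ∣
  ∣++∣ []            T = refl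
  ∣++∣ (inside ∷ S)  T = cong suc (∣++∣ S T)
  ∣++∣ (outside ∷ S) T = ∣++∣ S T

  ∣⊎ˢ∣ : ∀ {m} (S T : Subset m) → ∣ S ⊎ˢ T ∣ ≡ ∣ S ∣ + ∣ T ∣
  ∣⊎ˢ∣ S T = trans (∣++∣ S (T Vec.++ [])) (cong (∣ S ∣ +_) (trans (∣++∣ T []) (+-identityʳ ∣ T ∣)))

  halves : ∀ m (S : Subset (2 * m)) → ∃₂ λ A B → S ≡ A ⊎ˢ B
  halves m S = Vec.take m S , Vec.take m S′ ,
    trans (sym (Vec.take++drop≡id m S)) (cong (Vec.take m S Vec.++_)
      (trans (sym (Vec.take++drop≡id m S′)) (cong (Vec.take m S′ Vec.++_) (empty (Vec.drop m S′)))))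
    where
    S′ : Subset (m + 0)
    S′ = Vec.drop m S
    empty : (T : Subset 0) → T ≡ []
    empty [] = refl

  trie-view : ∀ N (S : Subset (2 ^ N)) → S ≡ ∅ ⊎ (∃ λ (t : Trie N) → S ≡ toSubset t)
  trie-view zero (inside ∷ [])  = inj₂ (leaf , refl)
  trie-view zero (outside ∷ []) = inj₁ refl
  trie-view (suc N) S with halves (2 ^ N) S
  ... | A , B , refl with trie-view N A | trie-view N B
  ...   | inj₁ refl       | inj₁ refl       = inj₁ (sym (⊥-⊎ˢ (2 ^ N)))
  ...   | inj₁ refl       | inj₂ (t , refl) = inj₂ (right t , refl)
  ...   | inj₂ (s , refl) | inj₁ refl       = inj₂ (left s , refl)
  ...   | inj₂ (s , refl) | inj₂ (t , refl) = inj₂ (node s t , refl)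

  -- Inclusion of tries and splitting coordinates

  infix 4 _≼_
  data _≼_ : ∀ {N} → Trie N → Trie N → Set where
    leaf       : leaf ≼ leaf
    left       : ∀ {N} {s t : Trie N} → s ≼ t → left s ≼ left t
    right      : ∀ {N} {s t : Trie N} → s ≼ t → right s ≼ right t
    node       : ∀ {N} {s s′ t t′ : Trie N} → s ≼ s′ → t ≼ t′ → node s t ≼ node s′ t′
    left-node  : ∀ {N} {s s′ t′ : Trie N} → s ≼ s′ → left s ≼ node s′ t′
    right-node : ∀ {N} {t s′ t′ : Trie N} → t ≼ t′ → right t ≼ node s′ t′

  ≼-refl : ∀ {N} (t : Trie N) → t ≼ t
  ≼-refl leaf       = leaf
  ≼-refl (left t)   = left (≼-refl t)
  ≼-refl (right t)  = right (≼-refl t)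
  ≼-refl (node s t) = node (≼-refl s) (≼-refl t)

  ≼-trans : ∀ {N} {s t u : Trie N} → s ≼ t → t ≼ u → s ≼ u
  ≼-trans leaf           leaf           = leaf
  ≼-trans (left p)       (left q)       = left (≼-trans p q)
  ≼-trans (left p)       (left-node q)  = left-node (≼-trans p q)
  ≼-trans (right p)      (right q)      = right (≼-trans p q)
  ≼-trans (right p)      (right-node q) = right-node (≼-trans p q)
  ≼-trans (node p p′)    (node q q′)    = node (≼-trans p q) (≼-trans p′ q′)
  ≼-trans (left-node p)  (node q _)     = left-node (≼-trans p q)
  ≼-trans (right-node p) (node _ q)     = right-node (≼-trans p q)

  ++-⊆ : ∀ {m n} (S S′ : Subset m) {T T′ : Subset n} → S ⊆ S′ → T ⊆ T′ → S Vec.++ T ⊆ S′ Vec.++ T′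
  ++-⊆ []           []        S⊆ T⊆ x         = T⊆ x
  ++-⊆ (inside ∷ S) (s′ ∷ S′) S⊆ T⊆ here with here ← S⊆ here = here
  ++-⊆ (s ∷ S)      (s′ ∷ S′) S⊆ T⊆ (there x) = there (++-⊆ S S′ (drop-∷-⊆ S⊆) T⊆ x)

  ⊎ˢ-⊆ : ∀ {m} (S S′ T T′ : Subset m) → S ⊆ S′ → T ⊆ T′ → S ⊎ˢ T ⊆ S′ ⊎ˢ T′
  ⊎ˢ-⊆ S S′ T T′ S⊆ T⊆ = ++-⊆ S S′ S⊆ (++-⊆ T T′ T⊆ λ x → x)

  toSubset-⊆ : ∀ {N} {s t : Trie N} → s ≼ t → toSubset s ⊆ toSubset t
  toSubset-⊆ leaf           = λ x → x
  toSubset-⊆ (left p)       = ⊎ˢ-⊆ _ _ ∅ ∅ (toSubset-⊆ p) ⊥⊆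
  toSubset-⊆ (right p)      = ⊎ˢ-⊆ ∅ ∅ _ _ ⊥⊆ (toSubset-⊆ p)
  toSubset-⊆ (node p q)     = ⊎ˢ-⊆ _ _ _ _ (toSubset-⊆ p) (toSubset-⊆ q)
  toSubset-⊆ (left-node {s = s} {s′} {t′} p) =
    ⊎ˢ-⊆ (toSubset s) (toSubset s′) ∅ (toSubset t′) (toSubset-⊆ p) ⊥⊆
  toSubset-⊆ (right-node {t = t} {s′} {t′} p) =
    ⊎ˢ-⊆ ∅ (toSubset s′) (toSubset t) (toSubset t′) ⊥⊆ (toSubset-⊆ p)

  -- The set of coordinates at which two vertices of the subset first differ; the
  -- head of a subset of the coordinates is the most significant one.
  Δ : ∀ {N} → Trie N → Subset N
  Δ leaf       = []
  Δ (left t)   = outside ∷ Δ t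
  Δ (right t)  = outside ∷ Δ t
  Δ (node s t) = inside ∷ (Δ s ∪ Δ t)

  -- The leaves in order, each marked by whether it is a right child of its
  -- branching node; x is the mark used when there is only one leaf.  For
  -- consecutive vertices with splitting coordinates δ₁,…,δₖ, the i-th leaf is a
  -- right child exactly if δᵢ₋₁ < δᵢ, where δ₀ = δₖ₊₁ = ∞.
  marks : ∀ {N} → Bool → Trie N → Word
  marks x leaf       = x ∷ []
  marks x (left t)   = marks x t
  marks x (right t)  = marks x t
  marks x (node s t) = marks false s ++ marks true t

  ∣toSubset∣ : ∀ {N} x (t : Trie N) → ∣ toSubset t ∣ ≡ length (marks x t)
  ∣toSubset∣ x leaf       = refl
  ∣toSubset∣ {suc N} x (left t)   = trans (∣⊎ˢ∣ (toSubset t) _)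
    (trans (cong₂ _+_ (∣toSubset∣ x t) (∣⊥∣≡0 (2 ^ N))) (+-identityʳ _))
  ∣toSubset∣ {suc N} x (right t)  = trans (∣⊎ˢ∣ ∅ (toSubset t))
    (cong₂ _+_ (∣⊥∣≡0 (2 ^ N)) (∣toSubset∣ x t))
  ∣toSubset∣ x (node s t) = trans (∣⊎ˢ∣ (toSubset s) (toSubset t))
    (trans (cong₂ _+_ (∣toSubset∣ false s) (∣toSubset∣ true t)) (sym (length-++ (marks false s))))

  -- Only a lone vertex shows the default mark. Among several, the first is always a left child and
  -- the last a right child, so all information lies in the word between them.
  data Marks {N} (t : Trie N) : Set where
    single : (∀ x → marks x t ≡ x ∷ []) → Δ t ≡ ∅ → Marks t
    many   : ∀ w → (∀ x → marks x t ≡ false ∷ w ∷ʳ true) → Marks t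

  marks-view : ∀ {N} (t : Trie N) → Marks t
  marks-view leaf = single (λ _ → refl) refl
  marks-view (left t) with marks-view t
  ... | single eq Δ≡⊥ = single eq (cong (outside ∷_) Δ≡⊥)
  ... | many w eq     = many w eq
  marks-view (right t) with marks-view t
  ... | single eq Δ≡⊥ = single eq (cong (outside ∷_) Δ≡⊥)
  ... | many w eq     = many w eq
  marks-view (node s t) with marks-view s | marks-view t
  ... | single eq _ | single eq′ _ = many [] λ x → cong₂ _++_ (eq false) (eq′ true)
  ... | single eq _ | many w eq′   = many (false ∷ w) λ x → cong₂ _++_ (eq false) (eq′ true)
  ... | many w eq   | single eq′ _ = many (w ∷ʳ true) λ x → cong₂ _++_ (eq false) (eq′ true)
  ... | many w eq   | many w′ eq′  = many (w ++ true ∷ false ∷ w′) λ x →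
    trans (cong₂ _++_ (eq false) (eq′ true))
          (cong (false ∷_) (trans (++-assoc w _ _) (sym (++-assoc w (true ∷ false ∷ w′) _))))

  ∷ʳ-as-∷ : ∀ w (x : Bool) → ∃₂ λ y v → w ∷ʳ x ≡ y ∷ v
  ∷ʳ-as-∷ []      x = x , [] , refl
  ∷ʳ-as-∷ (y ∷ w) x = y , w ∷ʳ x , refl

  ∷-as-∷ʳ : ∀ (x : Bool) w → ∃₂ λ v y → x ∷ w ≡ v ∷ʳ y
  ∷-as-∷ʳ x []      = [] , x , refl
  ∷-as-∷ʳ x (y ∷ w) = let v , z , eq = ∷-as-∷ʳ y w in x ∷ v , z , cong (x ∷_) eq

  -- Without the first vertex the second one comes first and is a left child: its mark `y` gives way
  -- to `false`, while all later marks stay.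
  drop-first : ∀ {N} (t : Trie N) {y w} → marks false t ≡ false ∷ y ∷ w →
               ∃ λ u → u ≼ t × marks false u ≡ false ∷ w
  drop-first (left t)  eq = let u , u≼t , eq′ = drop-first t eq in left u , left u≼t , eq′
  drop-first (right t) eq = let u , u≼t , eq′ = drop-first t eq in right u , right u≼t , eq′
  drop-first (node s t) {y} {w} eq with marks-view s
  ... | single eqₛ _ = right t , right-node (≼-refl t) , first (marks-view t)
    where
    eqₜ : marks true t ≡ y ∷ w
    eqₜ = ∷-injectiveʳ (trans (cong (_++ marks true t) (sym (eqₛ false))) eq)
    first : Marks t → marks false t ≡ false ∷ w
    first (single eq′ _) =
      trans (eq′ false) (cong (false ∷_) (∷-injectiveʳ (trans (sym (eq′ true)) eqₜ)))
    first (many _ eq′) =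
      trans (eq′ false) (cong (false ∷_) (∷-injectiveʳ (trans (sym (eq′ true)) eqₜ)))
  ... | many v eqₛ =
    let z , v′ , split = ∷ʳ-as-∷ v true
        eqₛ′           = trans (eqₛ false) (cong (false ∷_) split)
        u , u≼s , eq′  = drop-first s {z} {v′} eqₛ′
    in  node u t , node u≼s (≼-refl t) ,
        trans (cong (_++ marks true t) eq′) (cong (false ∷_)
          (∷-injectiveʳ (∷-injectiveʳ (trans (cong (_++ marks true t) (sym eqₛ′)) eq))))

  drop-last : ∀ {N} (t : Trie N) {y w} → marks true t ≡ w ∷ʳ y ∷ʳ true →
              ∃ λ u → u ≼ t × marks true u ≡ w ∷ʳ true
  drop-last leaf {y} {w} eq with w | ∷ʳ-injectiveˡ [] (w ∷ʳ y) eq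
  ... | []    | ()
  ... | _ ∷ _ | ()
  drop-last (left t)  eq = let u , u≼t , eq′ = drop-last t eq in left u , left u≼t , eq′
  drop-last (right t) eq = let u , u≼t , eq′ = drop-last t eq in right u , right u≼t , eq′
  drop-last (node s t) {y} {w} eq with marks-view t
  ... | single eqₜ _ = left s , left-node (≼-refl s) , last (marks-view s)
    where
    eqₛ : marks false s ≡ w ∷ʳ y
    eqₛ = ∷ʳ-injectiveˡ _ _ (trans (cong (marks false s ++_) (sym (eqₜ true))) eq)
    last : Marks s → marks true s ≡ w ∷ʳ true
    last (single eq′ _) =
      trans (eq′ true) (cong (_∷ʳ true) (∷ʳ-injectiveˡ [] w (trans (sym (eq′ false)) eqₛ)))
    last (many v eq′) =
      trans (eq′ true) (cong (_∷ʳ true) (∷ʳ-injectiveˡ (false ∷ v) w (trans (sym (eq′ false)) eqₛ)))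
  ... | many v eqₜ =
    let v′ , z , split = ∷-as-∷ʳ false v
        eqₜ′           = trans (eqₜ true) (cong (_∷ʳ true) split)
        u , u≼t , eq′  = drop-last t {z} {v′} eqₜ′
        eqₛ            = trans (cong (marks false s ++_) (sym eqₜ′)) eq
        rest           = ∷ʳ-injectiveˡ _ w (∷ʳ-injectiveˡ _ (w ∷ʳ y)
                         (trans (reassoc (marks false s) v′ z) eqₛ))
    in  node s u , node (≼-refl s) u≼t ,
        trans (cong (marks false s ++_) eq′)
              (trans (sym (++-assoc (marks false s) v′ _)) (cong (_∷ʳ true) rest))
    where
    reassoc : ∀ (a b : Word) z → ((a ++ b) ∷ʳ z) ∷ʳ true ≡ a ++ (b ∷ʳ z ∷ʳ true)
    reassoc a b z = trans (cong (_∷ʳ true) (++-assoc a b _)) (++-assoc a (b ∷ʳ z) _)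

  Framed : ∀ {N} → Trie N → Word → Set
  Framed t w = ∀ x → marks x t ≡ false ∷ w ∷ʳ true

  frame : ∀ {N} (t : Trie N) {x w} → marks x t ≡ false ∷ w ∷ʳ true → Framed t w
  frame t {x} {w} eq with marks-view t
  ... | many _ eq′     = λ y → trans (eq′ y) (trans (sym (eq′ x)) eq)
  ... | single eq′ _ with w | trans (sym (eq′ x)) eq
  ...   | []    | ()
  ...   | _ ∷ _ | ()

  suffix : ∀ {N} (t : Trie N) p {w} → Framed t (p ++ w) → ∃ λ u → u ≼ t × Framed u w
  suffix t []      eq = t , ≼-refl t , eq
  suffix t (y ∷ p) eq =
    let u , u≼t , eq′ = drop-first t (eq false)
        v , v≼u , eq″ = suffix u p (frame u eq′)
    in  v , ≼-trans v≼u u≼t , eq″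

  prefix : ∀ {N} (t : Trie N) w q → Framed t (w ++ q) → ∃ λ u → u ≼ t × Framed u w
  prefix t w []      eq = t , ≼-refl t , λ x →
    trans (eq x) (cong (λ v → false ∷ v ∷ʳ true) (++-identityʳ w))
  prefix t w (y ∷ q) eq =
    let u , u≼t , eq′ = prefix t (w ∷ʳ y) q λ x →
          trans (eq x) (cong (λ v → false ∷ v ∷ʳ true) (sym (++-assoc w _ q)))
        v , v≼u , eq″ = drop-last u {y} {false ∷ w} (eq′ true)
    in  v , ≼-trans v≼u u≼t , frame v eq″

  window : ∀ {N} (t : Trie N) p w q → Framed t (p ++ w ++ q) → ∃ λ u → u ≼ t × Framed u w
  window t p w q eq =
    let u , u≼t , eq′ = suffix t p eq
        v , v≼u , eq″ = prefix u w q eq′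
    in  v , ≼-trans v≼u u≼t , eq″

  marks-nonempty : ∀ {N} x (t : Trie N) → marks x t ≢ []
  marks-nonempty x t eq with marks-view t
  ... | single eq′ _ with () ← trans (sym (eq′ x)) eq
  ... | many _ eq′   with () ← trans (sym (eq′ x)) eq

  -- Sets with monotone splitting coordinates

  last-true : ∀ j p q → p ++ true ∷ q ≡ replicate j false ∷ʳ true → q ≡ []
  last-true zero    []      q eq = ∷-injectiveʳ eq
  last-true zero    (x ∷ []) q ()
  last-true zero    (x ∷ y ∷ p) q ()
  last-true (suc j) []      q ()
  last-true (suc j) (x ∷ p) q eq = last-true j p q (∷-injectiveʳ eq)

  first-false : ∀ j p q → p ++ false ∷ q ≡ false ∷ replicate j true → p ≡ []
  first-false j []      q eq = refl
  first-false j (x ∷ p) q eq = contradiction (∷-injectiveʳ eq) (no-false j p)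
    where
    no-false : ∀ j p → p ++ false ∷ q ≢ replicate j true
    no-false (suc j) (x ∷ p) eq = no-false j p (∷-injectiveʳ eq)
    no-false zero    []      ()
    no-false zero    (_ ∷ _) ()
    no-false (suc j) []      ()

  replicate-∷ʳ : ∀ n (x : Bool) → replicate n x ∷ʳ x ≡ replicate (suc n) x
  replicate-∷ʳ zero    x = refl
  replicate-∷ʳ (suc n) x = cong (x ∷_) (replicate-∷ʳ n x)

  -- Such a trie is a caterpillar: the left subtree of every branching node is a single vertex.
  -- Keeping this vertex at the nodes whose coordinate lies in `K`, and dropping it at the others,
  -- realises `K`. With the default mark `true` the pattern includes a lone vertex, where the
  -- recursion ends.
  descending : ∀ {N} (t : Trie N) j → marks true t ≡ replicate j false ∷ʳ true →
    ∣ Δ t ∣ ≡ j × (∀ K → K ⊆ Δ t → ∃ λ u →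
      u ≼ t × Δ u ≡ K × marks true u ≡ replicate ∣ K ∣ false ∷ʳ true)
  descending leaf zero eq = refl , λ { [] _ → leaf , leaf , refl , refl }
  descending leaf (suc zero)    ()
  descending leaf (suc (suc j)) ()
  descending (left t) j eq with descending t j eq
  ... | size , sub = size , λ where
    (outside ∷ K) K⊆ →
      let u , u≼t , Δu , eqᵤ = sub K (drop-∷-⊆ K⊆)
      in  left u , left u≼t , cong (outside ∷_) Δu , eqᵤ
    (inside ∷ K)  K⊆ → contradiction (K⊆ here) λ ()
  descending (right t) j eq with descending t j eq
  ... | size , sub = size , λ where
    (outside ∷ K) K⊆ →
      let u , u≼t , Δu , eqᵤ = sub K (drop-∷-⊆ K⊆)
      in  right u , right u≼t , cong (outside ∷_) Δu , eqᵤ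
    (inside ∷ K)  K⊆ → contradiction (K⊆ here) λ ()
  descending (node s t) j eq with marks-view s
  -- Two vertices on the left would put a mark `true` before the last position.
  ... | many w eqₛ = contradiction
    (last-true j (false ∷ w) (marks true t)
      (trans (cong (false ∷_) (sym (++-assoc w _ _)))
        (trans (cong (_++ marks true t) (sym (eqₛ false))) eq)))
    (marks-nonempty true t)
  ... | single eqₛ Δs≡⊥ with j | trans (cong (_++ marks true t) (sym (eqₛ false))) eq
  ...   | zero   | ()
  ...   | suc j′ | eq′ with descending t j′ (∷-injectiveʳ eq′)
  ...     | size , sub rewrite Δs≡⊥ | ∪-identityˡ (Δ t) = cong suc size , λ where
    (outside ∷ K) K⊆ →
      let u , u≼t , Δu , eqᵤ = sub K (drop-∷-⊆ K⊆)
      in  right u , right-node u≼t , cong (outside ∷_) Δu , eqᵤ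
    (inside ∷ K)  K⊆ →
      let u , u≼t , Δu , eqᵤ = sub K (drop-∷-⊆ K⊆)
      in  node s u , node (≼-refl s) u≼t ,
          cong (inside ∷_) (trans (cong (_∪ Δ u) Δs≡⊥) (trans (∪-identityˡ (Δ u)) Δu)) ,
          cong₂ _++_ (eqₛ false) eqᵤ

  -- Mirror image of `descending`: now the right subtrees are single vertices.
  ascending : ∀ {N} (t : Trie N) j → marks false t ≡ false ∷ replicate j true →
    ∣ Δ t ∣ ≡ j × (∀ K → K ⊆ Δ t → ∃ λ u →
      u ≼ t × Δ u ≡ K × marks false u ≡ false ∷ replicate ∣ K ∣ true)
  ascending leaf zero eq = refl , λ { [] _ → leaf , leaf , refl , refl }
  ascending leaf (suc j) ()
  ascending (left t) j eq with ascending t j eq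
  ... | size , sub = size , λ where
    (outside ∷ K) K⊆ →
      let u , u≼t , Δu , eqᵤ = sub K (drop-∷-⊆ K⊆)
      in  left u , left u≼t , cong (outside ∷_) Δu , eqᵤ
    (inside ∷ K)  K⊆ → contradiction (K⊆ here) λ ()
  ascending (right t) j eq with ascending t j eq
  ... | size , sub = size , λ where
    (outside ∷ K) K⊆ →
      let u , u≼t , Δu , eqᵤ = sub K (drop-∷-⊆ K⊆)
      in  right u , right u≼t , cong (outside ∷_) Δu , eqᵤ
    (inside ∷ K)  K⊆ → contradiction (K⊆ here) λ ()
  ascending (node s t) j eq with marks-view t
  ... | many w eqₜ = contradiction
    (first-false j (marks false s) (w ∷ʳ true) (trans (cong (marks false s ++_) (sym (eqₜ true))) eq))
    (marks-nonempty false s)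
  ... | single eqₜ Δt≡⊥ with j | trans (cong (marks false s ++_) (sym (eqₜ true))) eq
  ...   | zero   | eq′ = contradiction (∷ʳ-injectiveʳ (marks false s) [] eq′) λ ()
  ...   | suc j′ | eq′ with ascending s j′
          (∷ʳ-injectiveˡ (marks false s) _ (trans eq′ (cong (false ∷_) (sym (replicate-∷ʳ j′ true)))))
  ...     | size , sub rewrite Δt≡⊥ | ∪-identityʳ (Δ s) = cong suc size , λ where
    (outside ∷ K) K⊆ →
      let u , u≼s , Δu , eqᵤ = sub K (drop-∷-⊆ K⊆)
      in  left u , left-node u≼s , cong (outside ∷_) Δu , eqᵤ
    (inside ∷ K)  K⊆ →
      let u , u≼s , Δu , eqᵤ = sub K (drop-∷-⊆ K⊆)
      in  node u t , node u≼s (≼-refl t) ,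
          cong (inside ∷_) (trans (cong (Δ u ∪_) Δt≡⊥) (trans (∪-identityʳ (Δ u)) Δu)) ,
          trans (cong₂ _++_ eqᵤ (eqₜ true)) (cong (false ∷_) (replicate-∷ʳ ∣ K ∣ true))

  monotone : ∀ {N} (t : Trie N) r x → Framed t (replicate r x) →
    ∣ Δ t ∣ ≡ suc r × (∀ {m} K → ∣ K ∣ ≡ suc m → K ⊆ Δ t → ∃ λ u →
      u ≼ t × Δ u ≡ K × Framed u (replicate m x))
  monotone t r false eq = let size , sub = descending t (suc r) (eq true) in
    size , λ K ∣K∣ K⊆ → let u , u≼t , Δu , eqᵤ = sub K K⊆ in
      u , u≼t , Δu , frame u (trans eqᵤ (cong (λ n → replicate n false ∷ʳ true) ∣K∣))
  monotone t r true eq =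
    let size , sub = ascending t (suc r) (trans (eq false) (cong (false ∷_) (replicate-∷ʳ r true))) in
    size , λ {m} K ∣K∣ K⊆ → let u , u≼t , Δu , eqᵤ = sub K K⊆ in
      u , u≼t , Δu , frame u (trans eqᵤ (cong (false ∷_)
        (trans (cong (λ n → replicate n true) ∣K∣) (sym (replicate-∷ʳ m true)))))

  -- The stepped-up colouring

  middle : ∀ {N} → Trie N → Word
  middle t with marks-view t
  ... | single _ _ = []
  ... | many w _   = w

  middle-framed : ∀ {N} (t : Trie N) {w} → Framed t w → middle t ≡ w
  middle-framed t {w} eq with marks-view t
  ... | many v eq′ = ∷ʳ-injectiveˡ v w (∷-injectiveʳ (trans (sym (eq′ true)) (eq true)))
  ... | single eq′ _ with w | trans (sym (eq′ true)) (eq true)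
  ...   | []    | ()
  ...   | _ ∷ _ | ()

  -- Erdős–Hajnal and Conlon–Fox–Sudakov: a subset of {0,1}ᴺ whose splitting
  -- coordinates are monotone gets the colour of the set of these coordinates,
  -- any other one a colour read off its first turn.
  stepping-up : ∀ {h r L N} → (∀ w → length w ≡ L → Consistent h w → HasRun r w) →
                NotArrows (suc h) (suc r) N → NotArrows (2 + h) (2 + L) (2 ^ N)
  stepping-up {h} {r} {L} {N} has-run (χ , bad) = χ⁺ , bad⁺
    where
    -- Extends `χ` to sets of every size, since the size of `Δ t` is known only in the monotone
    -- case.
    χ̂ : Subset N → Fin 2
    χ̂ K with ∣ K ∣ ≟ suc h
    ... | yes k = χ (K , k)
    ... | no  _ = zero

    χ̂-χ : ∀ K k → χ̂ K ≡ χ (K , k)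
    χ̂-χ K k with ∣ K ∣ ≟ suc h
    ... | yes k′ = cong (λ k → χ (K , k)) (≡-irrelevant k′ k)
    ... | no  k≢ = contradiction k k≢

    paint : Trie N → Fin 2
    paint t = maybe′ colour (χ̂ (Δ t)) (turn (middle t))

    χ⁺ : Coloring (2 + h) (2 ^ N)
    χ⁺ (S , _) = maybe′ paint zero (fromSubset N S)

    bad⁺ : ∀ T → ∣ T ∣ ≡ 2 + L → ¬ Monochromatic χ⁺ T
    bad⁺ T ∣T∣ (c , mono) with trie-view N T
    ... | inj₁ refl = 0≢1+n (trans (sym (∣⊥∣≡0 (2 ^ N))) ∣T∣)
    ... | inj₂ (t , refl) with marks-view t
    ...   | single eq _ = 0≢1+n (suc-injective
            (trans (sym (cong length (eq true))) (trans (sym (∣toSubset∣ true t)) ∣T∣)))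
    ...   | many w eq = bad (Δ u) (proj₁ comb) (c , Δu-mono)
      where
      framed-size : ∀ (u : Trie N) {w} → Framed u w → ∣ toSubset u ∣ ≡ 2 + length w
      framed-size u {w} eq = trans (∣toSubset∣ true u) (trans (cong length (eq true))
        (cong suc (trans (length-++ w) (+-comm (length w) 1))))

      painted : ∀ {u v} → u ≼ t → Framed u v → length v ≡ h → paint u ≡ c
      painted {u} u≼t eqᵤ len = trans (cong (maybe′ paint zero) (sym (fromSubset-toSubset u)))
        (mono (toSubset u , trans (framed-size u eqᵤ) (cong (2 +_) len)) (toSubset-⊆ u≼t))

      turn-colour : ∀ p v q {b} → w ≡ p ++ v ++ q → length v ≡ h → turn v ≡ just b → colour b ≡ c
      turn-colour p v q refl len tb =
        let u , u≼t , eqᵤ = window t p v q eq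
        in  trans (sym (cong (maybe′ colour _) (trans (cong turn (middle-framed u eqᵤ)) tb)))
                  (painted u≼t eqᵤ len)

      consistent : Consistent h w
      consistent .Consistent.same-turn p v q p′ v′ q′ eq₁ len₁ t₁ eq₂ len₂ t₂ =
        colour-injective (trans (turn-colour p v q eq₁ len₁ t₁) (sym (turn-colour p′ v′ q′ eq₂ len₂ t₂)))

      constant-part : ∃₂ λ x u → u ≼ t × Framed u (replicate r x)
      constant-part with has-run w (+-cancelˡ-≡ 2 _ _ (trans (sym (framed-size t eq)) ∣T∣)) consistent
      ... | p , x , q , refl = x , window t p (replicate r x) q eq

      x = proj₁ constant-part
      u = proj₁ (proj₂ constant-part)
      u≼t = proj₁ (proj₂ (proj₂ constant-part))
      comb = monotone u r x (proj₂ (proj₂ (proj₂ constant-part)))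

      Δu-mono : ∀ K → proj₁ K ⊆ Δ u → χ K ≡ c
      -- `K` is the set of splitting coordinates of `2 + h` vertices whose interior word is
      -- constant. That word has no turn, so these vertices inherit the colour of `K`.
      Δu-mono (K , k) K⊆ = let v , v≼u , Δv≡K , eqᵥ = proj₂ comb K k K⊆ in begin
        χ (K , k)  ≡⟨ χ̂-χ K k ⟨
        χ̂ K        ≡⟨ cong χ̂ Δv≡K ⟨
        χ̂ (Δ v)
          ≡⟨ cong (maybe′ colour (χ̂ (Δ v))) (trans (cong turn (middle-framed v eqᵥ)) (turn-constant x h)) ⟨
        paint v    ≡⟨ painted (≼-trans v≼u u≼t) eqᵥ (length-replicate h) ⟩
        c          ∎
        where open ≡-Reasoning

  -- Iterated stepping-up

  towerℕ : ℕ → ℕ → ℕ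
  towerℕ zero    a = a
  towerℕ (suc i) a = 2 ^ towerℕ i a

  step-triples : ∀ {N} r → NotArrows 3 (2 + r) N → NotArrows 4 (3 + (r + r)) (2 ^ N)
  step-triples r = stepping-up λ w len con → run-two r len con

  step-even : ∀ {h n N} → 3 ≤ h → 2 + h ≤ 2 + n →
              NotArrows (suc h) (suc n) N → NotArrows (2 + h) (4 + n) (2 ^ N)
  step-even 3≤h h≤n = stepping-up λ w len con →
    run-any 3≤h (≤-trans h≤n (≤-reflexive (sym len))) len con

  step-odd : ∀ {n N} i → 1 ≤ i → 4 + i * 2 ≤ suc n →
             NotArrows (3 + i * 2) (suc n) N → NotArrows (4 + i * 2) (3 + n) (2 ^ N)
  step-odd i 1≤i i≤n = stepping-up λ w len con →
    run-even i (≤-trans i≤n (≤-reflexive (sym len))) len 1≤i con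

  -- With k the uniformity, the sizes are 5k/2 + 12p plus 1 for even k and plus 3/2 for odd k. The
  -- size 6(p + 1) at k = 3 becomes 11 + 12p at k = 4; after that the steps cost 3 and 2 in turn.
  even-uniformity : ∀ p i → NotArrows (4 + i * 2) (11 + (i * 5 + 12 * p))
                                 (towerℕ (2 + i * 2) (suc p * suc p))
  odd-uniformity : ∀ p i → NotArrows (5 + i * 2) (14 + (i * 5 + 12 * p))
                                 (towerℕ (3 + i * 2) (suc p * suc p))

  even-uniformity p zero = subst (λ n → NotArrows 4 n (towerℕ 2 (suc p * suc p))) (size p)
    (step-triples (4 + 6 * p)
      (subst (λ n → NotArrows 3 n (towerℕ 1 (suc p * suc p))) (size₀ p) (triple-colouring p)))
    where
    size : ∀ p → 3 + ((4 + 6 * p) + (4 + 6 * p)) ≡ 11 + 12 * p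
    size = solve-∀
    size₀ : ∀ p → 6 * suc p ≡ 2 + (4 + 6 * p)
    size₀ = solve-∀
  even-uniformity p (suc i) = step-odd (suc i) (s≤s z≤n)
    (+-mono-≤ {6} {14} (m≤m+n 6 8) (≤-trans (*-monoʳ-≤ i (s≤s (s≤s z≤n))) (m≤m+n (i * 5) (12 * p))))
    (odd-uniformity p i)

  odd-uniformity p i = step-even (m≤m+n 3 (i * 2))
    (+-mono-≤ {5} {12} (m≤m+n 5 7) (≤-trans (*-monoʳ-≤ i (s≤s (s≤s z≤n))) (m≤m+n (i * 5) (12 * p))))
    (even-uniformity p i)

  data EvenOdd : ℕ → Set where
    even : ∀ i → EvenOdd (i * 2)
    odd  : ∀ i → EvenOdd (suc (i * 2))

  evenOdd : ∀ n → EvenOdd n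
  evenOdd zero = even 0
  evenOdd (suc n) with evenOdd n
  ... | even i = odd i
  ... | odd i  = even (suc i)

  -- For positive `p` the constant is absorbed by a second `72 * p`, which is why 144 is twice 72;
  -- for `p` zero it is bounded by `n` directly.
  72p≤n : ∀ {c n} p → c ≤ 72 → c ≤ n → 144 * p ≤ n → c + 72 * p ≤ n
  72p≤n {c} zero c≤72 c≤n _ = ≤-trans (≤-reflexive (+-identityʳ c)) c≤n
  72p≤n {c} {n} (suc p) c≤72 c≤n 144p≤n = begin
    c + 72 * suc p                 ≤⟨ +-monoˡ-≤ (72 * suc p) (≤-trans c≤72 (m≤m*n 72 (suc p))) ⟩
    72 * suc p + 72 * suc p      ≡⟨ *-distribʳ-+ (suc p) 72 72 ⟨
    144 * suc p                      ≤⟨ 144p≤n ⟩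
    n                                  ∎
    where open ≤-Reasoning

  -- Since 5k/2 is at most 5n/6, a sixth of `n` is left for 12p + 1 or 12p + 3/2. Multiplied by 6
  -- this asks for 6 + 72p or 9 + 72p to be at most `n`.
  lower-bound : ∀ k n p → 2 ≤ k → 3 * k ≤ n → 144 * p ≤ n →
                NotArrows k n (towerℕ (k ∸ 2) (suc p * suc p))
  lower-bound 1 n p (s≤s ()) _ _
  lower-bound 2 n p _ 6≤n 144p≤n = NotArrows-monoˡ (begin
    4 * suc p          ≡⟨ *-distribˡ-+ 4 1 p ⟩
    4 + 4 * p        ≤⟨ +-monoʳ-≤ 4 (*-monoˡ-≤ p (m≤m+n 4 68)) ⟩
    4 + 72 * p       ≤⟨ 72p≤n p (m≤m+n 4 68) (≤-trans (m≤m+n 4 2) 6≤n) 144p≤n ⟩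
    n                    ∎) (graph-colouring p)
    where open ≤-Reasoning
  lower-bound 3 n p _ 9≤n 144p≤n = NotArrows-monoˡ (begin
    6 * suc p          ≡⟨ *-distribˡ-+ 6 1 p ⟩
    6 + 6 * p        ≤⟨ +-monoʳ-≤ 6 (*-monoˡ-≤ p (m≤m+n 6 66)) ⟩
    6 + 72 * p       ≤⟨ 72p≤n p (m≤m+n 6 66) (≤-trans (m≤m+n 6 3) 9≤n) 144p≤n ⟩
    n                    ∎) (triple-colouring p)
    where open ≤-Reasoning
  lower-bound (suc (suc (suc (suc j)))) n p _ 3k≤n 144p≤n with evenOdd j
  ... | even i = NotArrows-monoˡ (*-cancelˡ-≤ 6 (begin
    6 * (11 + (i * 5 + 12 * p))                  ≡⟨ identity i p ⟩
    (6 + 72 * p) + 5 * (3 * (4 + i * 2))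
      ≤⟨ +-mono-≤ (72p≤n p (m≤m+n 6 66) 6≤n 144p≤n) (*-monoʳ-≤ 5 3k≤n) ⟩
    n + 5 * n                                          ∎)) (even-uniformity p i)
    where
    open ≤-Reasoning
    identity : ∀ i p → 6 * (11 + (i * 5 + 12 * p)) ≡ (6 + 72 * p) + 5 * (3 * (4 + i * 2))
    identity = solve-∀
    6≤n : 6 ≤ n
    6≤n = ≤-trans (≤-trans (m≤m+n 6 6) (*-monoʳ-≤ 3 (m≤m+n 4 (i * 2)))) 3k≤n
  ... | odd i = NotArrows-monoˡ (*-cancelˡ-≤ 6 (begin
    6 * (14 + (i * 5 + 12 * p))                  ≡⟨ identity i p ⟩
    (9 + 72 * p) + 5 * (3 * (5 + i * 2))
      ≤⟨ +-mono-≤ (72p≤n p (m≤m+n 9 63) 9≤n 144p≤n) (*-monoʳ-≤ 5 3k≤n) ⟩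
    n + 5 * n                                          ∎)) (odd-uniformity p i)
    where
    open ≤-Reasoning
    identity : ∀ i p → 6 * (14 + (i * 5 + 12 * p)) ≡ (9 + 72 * p) + 5 * (3 * (5 + i * 2))
    identity = solve-∀
    9≤n : 9 ≤ n
    9≤n = ≤-trans (≤-trans (m≤m+n 9 6) (*-monoʳ-≤ 3 (m≤m+n 5 (i * 2)))) 3k≤n

open Combinatorics using (towerℕ; lower-bound; NotArrows-monoʳ; NotArrows⇒¬Arrows)
open import Data.Integer.Base as ℤ using (+_; -[1+_])
import Data.Integer.Properties as ℤ
import Data.Nat.DivMod as ℕ
import Data.Nat.Properties as ℕ
open import Data.Nat.Tactic.RingSolver using (solve-∀)
open import Data.Rational.Base
  using (ℚ; 0ℚ; _<_; _≤_; _*_; _/_; ↥_; ↧ₙ_; toℚᵘ; fromℚᵘ; nonNegative; +-*-rawSemiring)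
open import Data.Rational.Properties
import Data.Rational.Unnormalised.Base as ℚᵘ
import Data.Rational.Unnormalised.Properties as ℚᵘ
open import Algebra.Definitions.RawSemiring +-*-rawSemiring using (_^_)

-- Lower cuts of towers

fromℚᵘ-mono-≤ : ∀ {p q} → p ℚᵘ.≤ q → fromℚᵘ p ≤ fromℚᵘ q
fromℚᵘ-mono-≤ {p} {q} p≤q = toℚᵘ-cancel-≤
  (ℚᵘ.≤-respʳ-≃ (ℚᵘ.≃-sym (toℚᵘ-fromℚᵘ q)) (ℚᵘ.≤-respˡ-≃ (ℚᵘ.≃-sym (toℚᵘ-fromℚᵘ p)) p≤q))

toℚᵘ-fromℕ : ∀ n → toℚᵘ (fromℕ n) ℚᵘ.≃ ℚᵘ.mkℚᵘ (+ n) 0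
toℚᵘ-fromℕ n = toℚᵘ-fromℚᵘ (ℚᵘ.mkℚᵘ (+ n) 0)

fromℕ-mono-≤ : ∀ {m n} → m ℕ.≤ n → fromℕ m ≤ fromℕ n
fromℕ-mono-≤ {m} {n} m≤n = fromℚᵘ-mono-≤ {ℚᵘ.mkℚᵘ (+ m) 0} {ℚᵘ.mkℚᵘ (+ n) 0}
  (ℚᵘ.*≤* (ℤ.*-monoʳ-≤-nonNeg (+ 1) (ℤ.+≤+ m≤n)))

fromℕ-* : ∀ m n → fromℕ (m ℕ.* n) ≡ fromℕ m * fromℕ n
fromℕ-* m n = toℚᵘ-injective (begin
  toℚᵘ (fromℕ (m ℕ.* n))                ≈⟨ toℚᵘ-fromℕ (m ℕ.* n) ⟩
  ℚᵘ.mkℚᵘ (+ (m ℕ.* n)) 0               ≈⟨ ℚᵘ.*≡* (cong (ℤ._* + 1) (ℤ.pos-* m n)) ⟩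
  ℚᵘ.mkℚᵘ (+ m) 0 ℚᵘ.* ℚᵘ.mkℚᵘ (+ n) 0  ≈⟨ ℚᵘ.*-cong (toℚᵘ-fromℕ m) (toℚᵘ-fromℕ n) ⟨
  toℚᵘ (fromℕ m) ℚᵘ.* toℚᵘ (fromℕ n)    ≈⟨ toℚᵘ-homo-* (fromℕ m) (fromℕ n) ⟨
  toℚᵘ (fromℕ m * fromℕ n)              ∎)
  where open ℚᵘ.≃-Reasoning

fromℕ-^ : ∀ m n → fromℕ (m ℕ.^ n) ≡ fromℕ m ^ n
fromℕ-^ m zero    = refl
fromℕ-^ m (suc n) = trans (fromℕ-* m (m ℕ.^ n)) (cong (fromℕ m *_) (fromℕ-^ m n))

0≤fromℕ : ∀ n → 0ℚ ≤ fromℕ n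
0≤fromℕ n = fromℕ-mono-≤ {0} {n} ℕ.z≤n

fromℕ^-mono-≤ : ∀ m {x} n → fromℕ m ≤ x → fromℕ m ^ n ≤ x ^ n
fromℕ^-mono-≤ m     zero    m≤x = ≤-refl
fromℕ^-mono-≤ m {x} (suc n) m≤x = begin
  fromℕ m * fromℕ m ^ n  ≡⟨ cong (fromℕ m *_) (fromℕ-^ m n) ⟨
  fromℕ m * fromℕ (m ℕ.^ n)
    ≤⟨ *-monoʳ-≤-nonNeg (fromℕ (m ℕ.^ n)) {{nonNegative (0≤fromℕ (m ℕ.^ n))}} m≤x ⟩
  x * fromℕ (m ℕ.^ n)        ≡⟨ cong (x *_) (fromℕ-^ m n) ⟩
  x * fromℕ m ^ n
    ≤⟨ *-monoˡ-≤-nonNeg x {{nonNegative (≤-trans (0≤fromℕ m) m≤x)}} (fromℕ^-mono-≤ m n m≤x) ⟩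
  x * x ^ n  ∎
  where open ≤-Reasoning

<fromℕ⇒numerator< : ∀ {u} n → u < fromℕ n → ↥ u ℤ.< + (n ℕ.* ↧ₙ u)
<fromℕ⇒numerator< {u@record{}} n u<n with ℚᵘ.<-respʳ-≃ (toℚᵘ-fromℕ n) (toℚᵘ-mono-< u<n)
... | ℚᵘ.*<* lt = subst₂ ℤ._<_ (ℤ.*-identityʳ (↥ u)) (sym (ℤ.pos-* n (↧ₙ u))) lt

2^ℤ-mono : ∀ {z} m → z ℤ.< + m → 2^ℤ z ≤ fromℕ (2 ℕ.^ m)
2^ℤ-mono {+ n}      m (ℤ.+<+ n<m) = fromℕ-mono-≤ {2 ℕ.^ n} {2 ℕ.^ m} (ℕ.^-monoʳ-≤ 2 (ℕ.<⇒≤ n<m))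
2^ℤ-mono { -[1+ n ]} m _ = ≤-trans (≤1 (2 ℕ.^ suc n) {{ℕ.m^n≢0 2 (suc n)}})
  (fromℕ-mono-≤ {1} {2 ℕ.^ m} (ℕ.m^n>0 2 m))
  where
  ≤1 : ∀ d .{{_ : ℕ.NonZero d}} → + 1 / d ≤ fromℕ 1
  ≤1 (suc d) = fromℚᵘ-mono-≤ {ℚᵘ.mkℚᵘ (+ 1) d} {ℚᵘ.mkℚᵘ (+ 1) 0} (ℚᵘ.*≤* (ℤ.+≤+ (ℕ.s≤s ℕ.z≤n)))

-- If s^b < 2^a with a/b < n, then a < nb and s^b < (2^n)^b, so s cannot reach 2^n. Comparing powers
-- by contradiction avoids roots.
exp₂-fromℕ : ∀ {y} n → y ≤ᶜ fromℚ (fromℕ n) → exp₂ y ≤ᶜ fromℚ (fromℕ (2 ℕ.^ n))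
exp₂-fromℕ n y≤n (u , yu , inj₁ s<0) = <-≤-trans s<0 (0≤fromℕ (2 ℕ.^ n))
exp₂-fromℕ n y≤n {s} (u , yu , inj₂ s^b<) with s <? fromℕ (2 ℕ.^ n)
... | yes s<2^n = s<2^n
... | no  s≮2^n = contradiction (<-≤-trans s^b< (begin
  2^ℤ (↥ u)                    ≤⟨ 2^ℤ-mono (n ℕ.* ↧ₙ u) (<fromℕ⇒numerator< n (y≤n yu)) ⟩
  fromℕ (2 ℕ.^ (n ℕ.* ↧ₙ u))   ≡⟨ cong fromℕ (ℕ.^-*-assoc 2 n (↧ₙ u)) ⟨
  fromℕ ((2 ℕ.^ n) ℕ.^ ↧ₙ u)   ≡⟨ fromℕ-^ (2 ℕ.^ n) (↧ₙ u) ⟩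
  fromℕ (2 ℕ.^ n) ^ ↧ₙ u       ≤⟨ fromℕ^-mono-≤ (2 ℕ.^ n) (↧ₙ u) (≮⇒≥ s≮2^n) ⟩
  s ^ ↧ₙ u                     ∎)) (<-irrefl refl)
  where open ≤-Reasoning

tower≤towerℕ : ∀ i {x} a → x ≤ fromℕ a → tower (suc i) (fromℚ x) ≤ᶜ fromℚ (fromℕ (towerℕ i a))
tower≤towerℕ zero    a x≤a s<x = <-≤-trans s<x x≤a
tower≤towerℕ (suc i) a x≤a = exp₂-fromℕ (towerℕ i a) (tower≤towerℕ i a x≤a)

-- c₀ = 1/144²; the base colourings are used with q = 1 + ⌊n/144⌋.
c₀ : ℚ
c₀ = + 1 / 20736

c₀*n²≤q² : ∀ n q → n ℕ.≤ 144 ℕ.* q → c₀ * fromℕ (n ℕ.^ 2) ≤ fromℕ (q ℕ.* q)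
c₀*n²≤q² n q n≤144q = begin
  c₀ * fromℕ (n ℕ.^ 2)
    ≤⟨ *-monoˡ-≤-nonNeg c₀ (fromℕ-mono-≤ {n ℕ.^ 2} {(144 ℕ.* q) ℕ.^ 2} (ℕ.^-monoˡ-≤ 2 n≤144q)) ⟩
  c₀ * fromℕ ((144 ℕ.* q) ℕ.^ 2)    ≡⟨ cong (λ m → c₀ * fromℕ m) (square 144 q) ⟩
  c₀ * fromℕ (20736 ℕ.* (q ℕ.* q))  ≡⟨ cong (c₀ *_) (fromℕ-* 20736 (q ℕ.* q)) ⟩
  c₀ * (fromℕ 20736 * fromℕ (q ℕ.* q)) ≡⟨ *-assoc c₀ (fromℕ 20736) (fromℕ (q ℕ.* q)) ⟨
  -- The first product evaluates to 1, so only a unit has to be removed.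
  c₀ * fromℕ 20736 * fromℕ (q ℕ.* q) ≡⟨ *-identityˡ (fromℕ (q ℕ.* q)) ⟩
  fromℕ (q ℕ.* q)                  ∎
  where
  open ≤-Reasoning
  square : ∀ a q → a ℕ.* q ℕ.* (a ℕ.* q ℕ.* 1) ≡ a ℕ.* a ℕ.* (q ℕ.* q)
  square = solve-∀

mainTheorem4 : ∃ λ (c : ℚ) → 0ℚ < c ×
    ((k n : ℕ) → 2 ℕ.≤ k → 3 ℕ.* k ℕ.≤ n →
    (r : ℕ) → IsRamseyNumber k n r →
    tower (k ∸ 1) (fromℚ (c * fromℕ (n ℕ.^ 2))) ≤ᶜ fromℚ (fromℕ r))
mainTheorem4 = c₀ , positive⁻¹ c₀ , bound
  where
  bound : (k n : ℕ) → 2 ℕ.≤ k → 3 ℕ.* k ℕ.≤ n → (r : ℕ) → IsRamseyNumber k n r →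
          tower (k ∸ 1) (fromℚ (c₀ * fromℕ (n ℕ.^ 2))) ≤ᶜ fromℚ (fromℕ r)
  bound 1 n (ℕ.s≤s ())
  bound k@(suc (suc i)) n 2≤k 3k≤n r (arrows , _) s<tower = <-≤-trans
    (tower≤towerℕ i (q ℕ.* q) (c₀*n²≤q² n q n≤144q) s<tower)
    -- If `r` were below the tower, the bad colouring would restrict to `r` vertices and contradict
    -- the arrow relation there.
    (fromℕ-mono-≤ {towerℕ i (q ℕ.* q)} {r} (ℕ.≮⇒≥ λ r<N → NotArrows⇒¬Arrows
      (NotArrows-monoʳ (ℕ.≤⇒≤′ (ℕ.<⇒≤ r<N)) (lower-bound k n p 2≤k 3k≤n 144p≤n)) arrows))
    where
    p q : ℕ
    p = n ℕ./ 144
    q = suc p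
    144p≤n : 144 ℕ.* p ℕ.≤ n
    144p≤n = ℕ.≤-trans (ℕ.≤-reflexive (ℕ.*-comm 144 p)) (ℕ.m/n*n≤m n 144)
    n≤144q : n ℕ.≤ 144 ℕ.* q
    n≤144q = begin
      n                            ≡⟨ ℕ.m≡m%n+[m/n]*n n 144 ⟩
      n ℕ.% 144 ℕ.+ p ℕ.* 144      ≤⟨ ℕ.+-monoˡ-≤ (p ℕ.* 144) (ℕ.<⇒≤ (ℕ.m%n<n n 144)) ⟩
      q ℕ.* 144                    ≡⟨ ℕ.*-comm q 144 ⟩
      144 ℕ.* q                    ∎
      where open ℕ.≤-Reasoning
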